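{- There exists a constant $c_{3,5}>0$ such that $R(C_5^3,K_n^3)\leq c_{3,5}\,n^{4/3}$ for all $n$. More generally, for every fixed integer $l\geq 3$ there exists a constant $c_{3,l}>0$ such that for all $n$, $$R(C_l^3,K_n^3)\leq c_{3,l}\, n^{1+1/\lfloor (l+1)/2\rfloor}.$$
   Context: A loose cycle of length $l$ is a hypergraph with $l$ edges $e_1,\dots,e_l$ such that $|e_i\cap e_j|=1$ whenever $j\equiv i+1$ or $j\equiv i-1 \pmod l$, and $e_i\cap e_j=\emptyset$ otherwise. $C_l^r$ denotes an $r$-uniform loose cycle of length $l$ (all edges have size $r$), and $K_n^r$ denotes the complete $r$-uniform hypergraph on $n$ vertices. The Ramsey number $R(C_l^r,K_n^r)$ is the least integer $N$ such that every red/blue colouring of the edges of $K_N^r$ contains a red copy of $C_l^r$ or a blue copy of $K_n^r$. -}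

module Defs where

open import Data.Nat using (ℕ; suc; _+_; _*_; _^_; _≤_; _<_)
open import Data.Nat.DivMod using (_/_; _%_)
open import Data.Fin using (Fin; toℕ)
open import Data.Fin.Subset using (Subset; _⊆_; _∩_; ∣_∣)
open import Data.Product using (Σ; _×_; ∃-syntax)
open import Data.Sum using (_⊎_)
open import Relation.Binary.PropositionalEquality using (_≡_; _≢_)
open import Relation.Nullary using (¬_)

data Colour : Set where
  red blue : Colour

-- A red/blue colouring of the edges of K_N^3 (vertex set Fin N).
-- Edges of K_N^3 are the 3-element subsets of Fin N; a colouring is a
-- function on subsets of which only the values on 3-element subsets
-- are ever consulted.
Colouring : ℕ → Set
Colouring N = Subset N → Colour

CycAdj : (l : ℕ) → Fin l → Fin l → Set
CycAdj (suc l) i j =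
  (toℕ j ≡ (toℕ i + 1) % suc l) ⊎ (toℕ i ≡ (toℕ j + 1) % suc l)

RedLooseCycle : (l : ℕ) {N : ℕ} → Colouring N → Set
RedLooseCycle l {N} col =
  Σ (Fin l → Subset N) λ e →
    ((i : Fin l) → ∣ e i ∣ ≡ 3 × col (e i) ≡ red) ×
    ((i j : Fin l) → i ≢ j →
       (CycAdj l i j → ∣ e i ∩ e j ∣ ≡ 1) ×
       (¬ CycAdj l i j → ∣ e i ∩ e j ∣ ≡ 0))

BlueClique : (n : ℕ) {N : ℕ} → Colouring N → Set
BlueClique n {N} col =
  Σ (Subset N) λ S → ∣ S ∣ ≡ n ×
    ((e : Subset N) → e ⊆ S → ∣ e ∣ ≡ 3 → col e ≡ blue)

-- N has the Ramsey property for (C_l^3, K_n^3).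
-- R(C_l^3, K_n^3) is the least such N, so  R ≤ x  iff  ∃ N ≤ x with this property.
RamseyProp : (l n N : ℕ) → Set
RamseyProp l n N = (col : Colouring N) → RedLooseCycle l col ⊎ BlueClique n col

{-# OPTIONS --safe #-}
module Submission where

open import Defs
open import Data.Nat using (ℕ; suc; _+_; _*_; _^_; _≤_; _<_)
open import Data.Nat.DivMod using (_/_)
open import Data.Product using (_×_; ∃-syntax)

open import Data.Bool as Bool using (Bool; true; false; if_then_else_)
open import Data.Empty using (⊥; ⊥-elim)
open import Data.Fin as Fin using (Fin; toℕ) renaming (zero to fzero; suc to fsuc)
open import Data.Fin.Properties using (toℕ<n; toℕ-injective) renaming (_≟_ to _≟ᶠ_; <-cmp to <-cmpᶠ; <-trans to <-transᶠ; <-irrefl to <-irreflᶠ)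
open import Data.Fin.Subset using (Subset; ⁅_⁆; _∪_; _∩_; ∣_∣; inside; outside; _⊆_) renaming (⊥ to ∅; _∈_ to _∈ˢ_; _∉_ to _∉ˢ_)
open import Data.Fin.Subset.Properties using (∪-identityˡ; ∣⊥∣≡0; ∉⊥; x∈⁅x⁆; x∈⁅y⁆⇒x≡y; x∈p∪q⁺; x∈p∪q⁻; x∈p∩q⁺; x∈p∩q⁻; ⊆-antisym) renaming (_∈?_ to _∈ˢ?_)
open import Data.List using (List; []; _∷_; _++_; length; map; filter; take; allFin; cartesianProduct; concatMap)
open import Data.List.Membership.DecPropositional using () renaming (_∈?_ to mem?)
open import Data.List.Membership.Propositional using (_∈_; _∉_; find; lose)
open import Data.List.Membership.Propositional.Properties
open import Data.List.Properties using (length-++; length-map; length-take; length-tabulate; length-filter; filter-accept; filter-notAll; filter-none; filter-++; take-all; ++-assoc)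
open import Data.List.Relation.Unary.All as All using (All; []; _∷_)
open import Data.List.Relation.Unary.AllPairs as AllPairs using (AllPairs; []; _∷_; allPairs?)
import Data.List.Relation.Unary.AllPairs.Properties as AllPairsₚ
open import Data.List.Relation.Unary.Any using (Any; here; there; any?)
open import Data.List.Relation.Unary.Unique.Propositional using (Unique)
import Data.List.Relation.Unary.Unique.Propositional.Properties as Uniqueₚ
open import Data.Nat
open import Data.Nat.DivMod using (_%_; m<n⇒m%n≡m; n%n≡0; m/n*n≤m; /-monoˡ-≤)
open import Data.Nat.ListAction using (sum)
open import Data.Nat.Properties
open import Data.Nat.Tactic.RingSolver using (solve-∀)
open import Data.Product using (∃; _,_; proj₁; proj₂)
open import Data.Product.Properties using () renaming (≡-dec to ×-≡-dec)
open import Data.Sum using (_⊎_; inj₁; inj₂; [_,_]′)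
import Data.Vec
open import Data.Vec using ([]; _∷_)
open import Function using (_∘_; id)
open import Relation.Binary using (Transitive; tri<; tri≈; tri>)
open import Relation.Binary.PropositionalEquality
open import Relation.Nullary using (¬_; Dec; yes; no; contradiction; does; ¬?; _×-dec_; _⊎-dec_)

-- Let k = ⌊(l+1)/2⌋ and d ≈ n^(1/k), and suppose that there are about n·d vertices, no red loose
-- l-cycle and no independent set of size n. Call a pair heavy if it lies in many red edges; a heavy
-- pair can always be completed to an edge avoiding a bounded set.
--
-- (1) Independent sets whose link has a small vertex cover can be split off together with that cover,
-- so we may assume that covers of links have at least about d·|I| vertices.
-- (2) A set of edges all of whose pairs have large codegree unfolds into a cycle of any length.
-- Peeling off pairs of small codegree therefore assigns every edge to one of its pairs, boundedly
-- many edges to each pair. A greedy Turán-type argument then yields a vertex with about d² "leaves".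
-- (3) These leaves are the first level of a tree. Within a level, order pairs of vertices by the way
-- in which their routes to the root meet. There are boundedly many ways, each of them a strict
-- partial order, and a long monotone path in one of them closes up to a loose l-cycle through the
-- tree. Hence a positive proportion of the level is independent and contains no heavy pair, and by
-- (1) the next level is larger by a factor d. After k − 1 levels, more than n vertices are reached.

-- The exponent comes from the length of routes. Two vertices of level `i`, counted from 0, are
-- joined by a route of at most `2 * suc i` links, and a cycle of length `l` needs at least one
-- further link inside the level. So the last level `q` must satisfy `2 * suc q < l`, and
-- `q = k − 2` is the largest choice. Such a tree has only k - 1 levels; with a factor d per level
-- it would stop at d^(k-1) vertices, short of n by a factor d. Step (2) supplies this factor: the
-- first level starts at d² instead of d. Edges that share two vertices are the obstacle throughout,
-- since they cannot be consecutive in a loose cycle. Wherever they may occur, either the pairs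
-- involved are heavy, so that third vertices can be chosen afresh at the very end, or a light pair
-- has boundedly many edges, which can be discarded. Paths therefore carry links without a third
-- vertex until the cycle is closed.

infixl 5 _∖_

-- Finite lists: pigeonhole, averaging, double counting and a cut lemma.

_∈?_ : ∀ {N} (x : Fin N) xs → Dec (x ∈ xs)
_∈?_ = mem? _≟ᶠ_

_∖_ : ∀ {N} → List (Fin N) → List (Fin N) → List (Fin N)
xs ∖ ys = filter (λ x → ¬? (x ∈? ys)) xs

Distinct : {A B : Set} → (A → B) → List A → Set
Distinct f = AllPairs (λ a b → f a ≢ f b)

∈-++-delete : {A : Set} {x y : A} (ys : List A) {zs : List A} →
              x ∈ ys ++ y ∷ zs → x ≢ y → x ∈ ys ++ zs
∈-++-delete ys p x≢y with ∈-++⁻ ys p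
... | inj₁ q = ∈-++⁺ˡ q
... | inj₂ (here eq) = contradiction eq x≢y
... | inj₂ (there q) = ∈-++⁺ʳ ys q

distinct-length : {A B : Set} (f : A → B) {xs : List A} {zs : List B} →
                  Distinct f xs → (∀ {x} → x ∈ xs → f x ∈ zs) → length xs ≤ length zs
distinct-length f [] _ = z≤n
distinct-length f {x ∷ xs} {zs} (px ∷ pxs) sub with ∈-∃++ (sub (here refl))
... | ys , ws , refl = begin
  suc (length xs)                  ≤⟨ s≤s (distinct-length f pxs λ {y} y∈ →
                                        ∈-++-delete ys (sub (there y∈)) (All.lookup px y∈ ∘ sym)) ⟩
  suc (length (ys ++ ws))          ≡⟨ cong suc (length-++ ys) ⟩
  suc (length ys + length ws)      ≡⟨ sym (+-suc (length ys) (length ws)) ⟩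
  length ys + suc (length ws)      ≡⟨ sym (length-++ ys) ⟩
  length (ys ++ f x ∷ ws)          ∎
  where open ≤-Reasoning

module _ {A : Set} {P : A → Set} (P? : ∀ x → Dec (P x)) where

  length-filter-split : ∀ xs → length xs ≡ length (filter P? xs) + length (filter (¬? ∘ P?) xs)
  length-filter-split [] = refl
  length-filter-split (x ∷ xs) with P? x
  ... | yes _ = cong suc (length-filter-split xs)
  ... | no  _ = trans (cong suc (length-filter-split xs)) (sym (+-suc _ _))

module _ {N : ℕ} where

  ∈-∖⁻ : ∀ {x : Fin N} {xs} ys → x ∈ xs ∖ ys → x ∈ xs × x ∉ ys
  ∈-∖⁻ {xs = xs} ys = ∈-filter⁻ (λ x → ¬? (x ∈? ys)) {xs = xs}

  ∖-unique : ∀ {xs : List (Fin N)} ys → Unique xs → Unique (xs ∖ ys)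
  ∖-unique ys = Uniqueₚ.filter⁺ (λ x → ¬? (x ∈? ys))

  length-∖ : ∀ {xs : List (Fin N)} ys → Unique xs → length xs ≤ length (xs ∖ ys) + length ys
  length-∖ {xs} ys u = begin
    length xs
      ≡⟨ length-filter-split (_∈? ys) xs ⟩
    length (filter (_∈? ys) xs) + length (xs ∖ ys)
      ≤⟨ +-monoˡ-≤ _ (distinct-length id (Uniqueₚ.filter⁺ (_∈? ys) u)
           (λ p → proj₂ (∈-filter⁻ (_∈? ys) {xs = xs} p))) ⟩
    length ys + length (xs ∖ ys)
      ≡⟨ +-comm (length ys) _ ⟩
    length (xs ∖ ys) + length ys ∎
    where open ≤-Reasoning

  fresh : ∀ {xs : List (Fin N)} ys → Unique xs → length ys < length xs → ∃[ x ] x ∈ xs × x ∉ ys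
  fresh {xs} ys u lt with any? (λ x → ¬? (x ∈? ys)) xs
  ... | yes p = find p
  ... | no ¬p = contradiction lt (≤⇒≯ (distinct-length id u λ {x} x∈ → mem x x∈))
    where
    mem : ∀ x → x ∈ xs → x ∈ ys
    mem x x∈ with x ∈? ys
    ... | yes q = q
    ... | no ¬q = contradiction (lose x∈ ¬q) ¬p

below-average : {A : Set} (f : A → ℕ) (xs : List A) (c : ℕ) → 0 < length xs →
                sum (map f xs) ≤ c * length xs → ∃[ x ] x ∈ xs × f x ≤ c
below-average f xs c pos le with any? (λ x → f x ≤? c) xs
... | yes p = find p
... | no ¬p = contradiction le (<⇒≱ (begin-strict
  c * length xs        <⟨ *-monoˡ-< (length xs) {{>-nonZero pos}} (n<1+n c) ⟩
  suc c * length xs    ≤⟨ big xs (λ x∈ → ≰⇒> λ q → ¬p (lose x∈ q)) ⟩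
  sum (map f xs)       ∎))
  where
  open ≤-Reasoning
  big : ∀ xs → (∀ {x} → x ∈ xs → c < f x) → suc c * length xs ≤ sum (map f xs)
  big [] _ = ≤-reflexive (*-zeroʳ (suc c))
  big (x ∷ xs) h = begin
    suc c * suc (length xs)         ≡⟨ *-suc (suc c) (length xs) ⟩
    suc c + suc c * length xs       ≤⟨ +-mono-≤ (h (here refl)) (big xs (h ∘ there)) ⟩
    f x + sum (map f xs)            ∎

sum-map-+ : {A : Set} (f g : A → ℕ) (xs : List A) →
            sum (map (λ x → f x + g x) xs) ≡ sum (map f xs) + sum (map g xs)
sum-map-+ f g [] = refl
sum-map-+ f g (x ∷ xs) rewrite sum-map-+ f g xs = lem (f x) (g x) (sum (map f xs)) (sum (map g xs))
  where
  lem : ∀ a b c d → a + b + (c + d) ≡ a + c + (b + d)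
  lem = solve-∀

sum-map-* : {A : Set} (c : ℕ) (f : A → ℕ) (xs : List A) →
            sum (map (λ x → c * f x) xs) ≡ c * sum (map f xs)
sum-map-* c f [] = sym (*-zeroʳ c)
sum-map-* c f (x ∷ xs) rewrite sum-map-* c f xs = sym (*-distribˡ-+ c (f x) _)

module _ {A B : Set} {P : A → B → Set} (P? : ∀ x y → Dec (P x y)) where

  private
    column : ∀ xs y ys → sum (map (λ x → length (filter (P? x) (y ∷ ys))) xs) ≡
             length (filter (λ x → P? x y) xs) + sum (map (λ x → length (filter (P? x) ys)) xs)
    column [] y ys = refl
    column (x ∷ xs) y ys with P? x y
    ... | no _ = trans (cong (length (filter (P? x) ys) +_) (column xs y ys))
                   (lem (length (filter (P? x) ys)) (length (filter (λ x → P? x y) xs)) _)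
      where
      lem : ∀ a b c → a + (b + c) ≡ b + (a + c)
      lem = solve-∀
    ... | yes _ = cong suc (trans (cong (length (filter (P? x) ys) +_) (column xs y ys))
                   (lem (length (filter (P? x) ys)) (length (filter (λ x → P? x y) xs)) _))
      where
      lem : ∀ a b c → a + (b + c) ≡ b + (a + c)
      lem = solve-∀

  double-count : ∀ xs ys b → (∀ {y} → y ∈ ys → length (filter (λ x → P? x y) xs) ≤ b) →
                 sum (map (λ x → length (filter (P? x) ys)) xs) ≤ b * length ys
  double-count xs [] b _ = ≤-reflexive (trans (zeros xs) (sym (*-zeroʳ b)))
    where
    zeros : ∀ xs → sum (map (λ x → length (filter (P? x) [])) xs) ≡ 0
    zeros [] = refl
    zeros (x ∷ xs) = zeros xs
  double-count xs (y ∷ ys) b h = begin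
    sum (map (λ x → length (filter (P? x) (y ∷ ys))) xs)
      ≡⟨ column xs y ys ⟩
    length (filter (λ x → P? x y) xs) + sum (map (λ x → length (filter (P? x) ys)) xs)
      ≤⟨ +-mono-≤ (h (here refl)) (double-count xs ys b (h ∘ there)) ⟩
    b + b * length ys
      ≡⟨ sym (*-suc b (length ys)) ⟩
    b * suc (length ys) ∎
    where open ≤-Reasoning

module _ {A : Set} {N : ℕ} (key : A → Fin N) (D : ℕ) where

  -- Greedy choice: keeping one element costs at most the `D` elements that share its key.
  select-distinct : (xs : List A) → (∀ k → length (filter (λ x → key x ≟ᶠ k) xs) ≤ D) →
    ∃[ ys ] (∀ {x} → x ∈ ys → x ∈ xs) × Distinct key ys × length xs ≤ D * length ys
  select-distinct xs = go (length xs) xs ≤-refl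
    where
    go : ∀ fuel xs → length xs ≤ fuel → (∀ k → length (filter (λ x → key x ≟ᶠ k) xs) ≤ D) →
      ∃[ ys ] (∀ {x} → x ∈ ys → x ∈ xs) × Distinct key ys × length xs ≤ D * length ys
    go _ [] _ _ = [] , id , [] , z≤n
    go (suc fuel) (x ∷ xs) (s≤s le) h =
      x ∷ ys , sub , All.tabulate (λ y∈ eq → proj₂ (inRest y∈) (sym eq)) ∷ dist , bound
      where
      other? = λ y → ¬? (key y ≟ᶠ key x)
      rest = filter other? xs
      sparse : ∀ {P : A → Set} (P? : ∀ x → Dec (P x)) zs →
               length (filter P? (filter other? zs)) ≤ length (filter P? zs)
      sparse P? [] = z≤n
      sparse P? (z ∷ zs) with key z ≟ᶠ key x | P? z in eq
      ... | yes _ | yes _ = m≤n⇒m≤1+n (sparse P? zs)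
      ... | yes _ | no _ = sparse P? zs
      ... | no _ | yes _ rewrite eq = s≤s (sparse P? zs)
      ... | no _ | no _ rewrite eq = sparse P? zs
      shorter : ∀ {P : A → Set} (P? : ∀ x → Dec (P x)) →
                length (filter P? xs) ≤ length (filter P? (x ∷ xs))
      shorter P? with P? x
      ... | yes _ = n≤1+n _
      ... | no _ = ≤-refl
      rec = go fuel rest (≤-trans (length-filter other? xs) le)
               (λ k → ≤-trans (sparse (λ x → key x ≟ᶠ k) xs)
                        (≤-trans (shorter (λ x → key x ≟ᶠ k)) (h k)))
      ys = proj₁ rec
      dist = proj₁ (proj₂ (proj₂ rec))
      inRest : ∀ {y} → y ∈ ys → y ∈ xs × key y ≢ key x
      inRest y∈ = ∈-filter⁻ other? (proj₁ (proj₂ rec) y∈)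
      sub : ∀ {y} → y ∈ x ∷ ys → y ∈ x ∷ xs
      sub (here eq) = here eq
      sub (there y∈) = there (proj₁ (inRest y∈))
      same? = λ y → key y ≟ᶠ key x
      bound : suc (length xs) ≤ D * suc (length ys)
      bound = begin
        suc (length xs)
          ≡⟨ cong suc (length-filter-split same? xs) ⟩
        suc (length (filter same? xs)) + length rest
          ≡⟨ cong (λ zs → length zs + length rest) (sym (filter-accept same? {x} {xs} refl)) ⟩
        length (filter same? (x ∷ xs)) + length rest
          ≤⟨ +-mono-≤ (h (key x)) (proj₂ (proj₂ (proj₂ rec))) ⟩
        D + D * length ys
          ≡⟨ sym (*-suc D (length ys)) ⟩
        D * suc (length ys) ∎
        where open ≤-Reasoning

-- Method of conditional expectations, with a pair weighted by 4 times its chance of being cut.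
module _ {A : Set} {N : ℕ} (tail head : A → Fin N) where

  private
    data Side : Set where
      undecided left right : Side

    α β : Side → ℕ
    α undecided = 1
    α left = 2
    α right = 0
    β undecided = 1
    β left = 0
    β right = 2

    weight : (Fin N → Side) → A → ℕ
    weight s x = α (s (tail x)) * β (s (head x))

    total : (Fin N → Side) → List A → ℕ
    total s xs = sum (map (weight s) xs)

    update : (Fin N → Side) → Fin N → Side → Fin N → Side
    update s v c u = if does (u ≟ᶠ v) then c else s u

    -- Since `tail` and `head` differ, deciding `v` changes at most one factor of each weight, and
    -- the value of an undecided factor is the mean of its values on the two sides. Hence one of the
    -- two decisions does not lower the total.
    split : ∀ s v xs → s v ≡ undecided → (∀ {x} → x ∈ xs → tail x ≢ head x) →
            total (update s v left) xs + total (update s v right) xs ≡ 2 * total s xs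
    split s v [] _ _ = refl
    split s v (x ∷ xs) eq h = begin
      weight l x + total l xs + (weight r x + total r xs)
        ≡⟨ swap (weight l x) (total l xs) (weight r x) (total r xs) ⟩
      (weight l x + weight r x) + (total l xs + total r xs)
        ≡⟨ cong₂ _+_ single (split s v xs eq (h ∘ there)) ⟩
      2 * weight s x + 2 * total s xs
        ≡⟨ sym (*-distribˡ-+ 2 (weight s x) (total s xs)) ⟩
      2 * (weight s x + total s xs) ∎
      where
      open ≡-Reasoning
      l = update s v left
      r = update s v right
      swap : ∀ a b c d → a + b + (c + d) ≡ a + c + (b + d)
      swap = solve-∀
      single : weight l x + weight r x ≡ 2 * weight s x
      single with tail x ≟ᶠ v | head x ≟ᶠ v
      ... | yes p | yes q = contradiction (trans p (sym q)) (h (here refl))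
      ... | yes p | no _ rewrite p | eq = lem (β (s (head x)))
        where
        lem : ∀ a → a + (a + 0) + 0 ≡ a + 0 + (a + 0 + 0)
        lem = solve-∀
      ... | no _ | yes q rewrite q | eq = lem (α (s (tail x)))
        where
        lem : ∀ a → a * 0 + a * 2 ≡ a * 1 + (a * 1 + 0)
        lem = solve-∀
      ... | no _ | no _ = lem (weight s x)
        where
        lem : ∀ a → a + a ≡ a + (a + 0)
        lem = solve-∀

    larger : ∀ a b c → a + b ≡ 2 * c → c ≤ a ⊎ c ≤ b
    larger a b c eq with c ≤? a | c ≤? b
    ... | yes p | _ = inj₁ p
    ... | no _ | yes q = inj₂ q
    ... | no p | no q = contradiction eq (<⇒≢ (subst (a + b <_) (lem c) (+-mono-< (≰⇒> p) (≰⇒> q))))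
      where
      lem : ∀ c → c + c ≡ 2 * c
      lem = solve-∀

    update-same : ∀ s v c → update s v c v ≡ c
    update-same s v c with v ≟ᶠ v
    ... | yes _ = refl
    ... | no ne = contradiction refl ne

    update-decided : ∀ s v c u → c ≢ undecided → s u ≢ undecided → update s v c u ≢ undecided
    update-decided s v c u hc hs with u ≟ᶠ v
    ... | yes _ = hc
    ... | no _ = hs

    settle : ∀ xs → (∀ {x} → x ∈ xs → tail x ≢ head x) → ∀ vs s →
             ∃[ s′ ] total s xs ≤ total s′ xs × (∀ {v} → v ∈ vs → s′ v ≢ undecided) ×
                     (∀ v → s v ≢ undecided → s′ v ≢ undecided)
    settle xs h [] s = s , ≤-refl , (λ ()) , λ _ → id
    settle xs h (v ∷ vs) s with s v in eq
    ... | left = let s′ , le , d , k = settle xs h vs s in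
      s′ , le , (λ { (here refl) → k v (λ e → case (trans (sym eq) e)) ; (there p) → d p }) , k
      where case : left ≢ undecided
            case ()
    ... | right = let s′ , le , d , k = settle xs h vs s in
      s′ , le , (λ { (here refl) → k v (λ e → case (trans (sym eq) e)) ; (there p) → d p }) , k
      where case : right ≢ undecided
            case ()
    ... | undecided with larger _ _ _ (split s v xs eq h)
    ...   | inj₁ q = let s′ , le , d , k = settle xs h vs (update s v left) in
      s′ , ≤-trans q le ,
      (λ { (here refl) → k v (λ e → case (trans (sym (update-same s v left)) e)) ; (there p) → d p }) ,
      λ u ne → k u (update-decided s v left u (λ ()) ne)
      where case : left ≢ undecided
            case ()
    ...   | inj₂ q = let s′ , le , d , k = settle xs h vs (update s v right) in
      s′ , ≤-trans q le ,
      (λ { (here refl) → k v (λ e → case (trans (sym (update-same s v right)) e)) ; (there p) → d p }) ,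
      λ u ne → k u (update-decided s v right u (λ ()) ne)
      where case : right ≢ undecided
            case ()

    isLeft : Side → Bool
    isLeft left = true
    isLeft _ = false

  cut? : (c : Fin N → Bool) (x : A) → Dec (c (tail x) ≡ true × c (head x) ≡ false)
  cut? c x = (c (tail x) Bool.≟ true) ×-dec (c (head x) Bool.≟ false)

  quarter-cut : (xs : List A) → (∀ {x} → x ∈ xs → tail x ≢ head x) →
                ∃[ c ] length xs ≤ 4 * length (filter (cut? c) xs)
  quarter-cut xs h with settle xs h (allFin N) (λ _ → undecided)
  ... | s , le , d , _ = isLeft ∘ s , ≤-trans (≤-trans (≤-reflexive (start xs)) le) (end xs)
    where
    start : ∀ xs → length xs ≡ total (λ _ → undecided) xs
    start [] = refl
    start (x ∷ xs) = cong suc (start xs)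
    -- Once every vertex is decided, a cut pair weighs 2 · 2 = 4 and every other pair 0.
    end : ∀ xs → total s xs ≤ 4 * length (filter (cut? (isLeft ∘ s)) xs)
    end [] = z≤n
    end (x ∷ xs) with s (tail x) | d (∈-allFin (tail x)) | s (head x) | d (∈-allFin (head x)) | end xs
    ... | undecided | ne | _ | _ | _ = contradiction refl ne
    ... | left | _ | undecided | ne | _ = contradiction refl ne
    ... | right | _ | undecided | ne | _ = contradiction refl ne
    ... | left | _ | left | _ | ih = ih
    ... | left | _ | right | _ | ih = ≤-trans (+-monoʳ-≤ 4 ih) (≤-reflexive (sym (*-suc 4 _)))
    ... | right | _ | left | _ | ih = ih
    ... | right | _ | right | _ | ih = ih

-- Constructive alternatives and sparse directed graphs.

∀-or : ∀ {n} {X : Set} {P : Fin n → Set} → (∀ i → X ⊎ P i) → X ⊎ (∀ i → P i)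
∀-or {zero} h = inj₂ λ ()
∀-or {suc n} h with h fzero | ∀-or (h ∘ fsuc)
... | inj₁ x | _ = inj₁ x
... | inj₂ _ | inj₁ x = inj₁ x
... | inj₂ p | inj₂ ps = inj₂ λ { fzero → p ; (fsuc i) → ps i }

-- Lists of bounded length over a finite set can be searched. The failing list is returned
-- explicitly because it later serves as the bounded cover of a poor vertex.
short-lists : ∀ {n} (c : ℕ) {P : List (Fin n) → Set} → (∀ ys → Dec (P ys)) →
              (∃[ ys ] length ys ≤ c × ¬ P ys) ⊎ (∀ ys → length ys ≤ c → P ys)
short-lists c P? with P? []
... | no ¬p = inj₁ ([] , z≤n , ¬p)
short-lists zero P? | yes p = inj₂ λ { [] _ → p }
short-lists {n} (suc c) {P} P? | yes p = [ inj₁ , (λ h → inj₂ λ { [] _ → p ; (y ∷ ys) (s≤s le) → h y ys le }) ]′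
  (∀-or λ y → extend y (short-lists c (λ ys → P? (y ∷ ys))))
  where
  extend : ∀ y {Q : Set} → (∃[ ys ] length ys ≤ c × ¬ P (y ∷ ys)) ⊎ Q →
           (∃[ ys ] length ys ≤ suc c × ¬ P ys) ⊎ Q
  extend y (inj₁ (ys , le , ¬p)) = inj₁ (y ∷ ys , s≤s le , ¬p)
  extend y (inj₂ q) = inj₂ q

module _ {N : ℕ} (K : Fin N → List (Fin N)) (c : ℕ) (K-short : ∀ v → length (K v) ≤ c) where

  -- Read `K u` as the out-neighbours of `u`. In-degrees average at most `c` as well, so some `u` in
  -- `B` has in-degree at most `c`; taking it costs `u` and at most `c` neighbours in either
  -- direction.
  sparse-independent : ∀ B → Unique B →
    ∃[ I ] (∀ {x} → x ∈ I → x ∈ B) × Unique I × length B ≤ suc (c + c) * length I ×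
           (∀ {u v} → u ∈ I → v ∈ I → u ≢ v → v ∉ K u)
  sparse-independent B = go (length B) B ≤-refl
    where
    go : ∀ fuel B → length B ≤ fuel → Unique B →
      ∃[ I ] (∀ {x} → x ∈ I → x ∈ B) × Unique I × length B ≤ suc (c + c) * length I ×
             (∀ {u v} → u ∈ I → v ∈ I → u ≢ v → v ∉ K u)
    go _ [] _ _ = [] , (λ ()) , [] , z≤n , λ ()
    go (suc fuel) B@(b ∷ bs) (s≤s le) uB = choose (below-average inDeg B c (s≤s z≤n)
      (double-count (λ u v → u ∈? K v) B B c λ {v} _ →
        ≤-trans (distinct-length id (Uniqueₚ.filter⁺ (_∈? K v) uB)
                  (λ p → proj₂ (∈-filter⁻ (_∈? K v) {xs = B} p))) (K-short v)))
      where
      inDeg : Fin N → ℕ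
      inDeg u = length (filter (λ v → u ∈? K v) B)
      Goal = ∃[ I ] (∀ {x} → x ∈ I → x ∈ B) × Unique I × length B ≤ suc (c + c) * length I ×
             (∀ {u v} → u ∈ I → v ∈ I → u ≢ v → v ∉ K u)
      choose : (∃[ u ] u ∈ B × inDeg u ≤ c) → Goal
      choose (u , u∈B , deg) = u ∷ I , sub , All.tabulate (λ y∈ eq → proj₂ (inRest y∈) (here (sym eq))) ∷ uI ,
          bound , indep
        where
        nbrs = filter (λ v → u ∈? K v) B
        gone = u ∷ K u ++ nbrs
        rest = B ∖ gone
        rec = go fuel rest (≤-pred (≤-trans
                (filter-notAll (λ x → ¬? (x ∈? gone)) B (lose u∈B λ ne → ne (here refl))) (s≤s le)))
                (∖-unique gone uB)
        I = proj₁ rec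
        uI = proj₁ (proj₂ (proj₂ rec))
        inRest : ∀ {x} → x ∈ I → x ∈ B × x ∉ gone
        inRest x∈ = ∈-∖⁻ gone (proj₁ (proj₂ rec) x∈)
        sub : ∀ {x} → x ∈ u ∷ I → x ∈ B
        sub (here refl) = u∈B
        sub (there x∈) = proj₁ (inRest x∈)
        bound : length B ≤ suc (c + c) * suc (length I)
        bound = begin
          length B                                        ≤⟨ length-∖ gone uB ⟩
          length rest + length gone                       ≡⟨ cong (λ z → length rest + suc z) (length-++ (K u)) ⟩
          length rest + suc (length (K u) + length nbrs)  ≤⟨ +-mono-≤ (proj₁ (proj₂ (proj₂ (proj₂ rec))))
                                                               (s≤s (+-mono-≤ (K-short u) deg)) ⟩
          suc (c + c) * length I + suc (c + c)            ≡⟨ +-comm (suc (c + c) * length I) _ ⟩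
          suc (c + c) + suc (c + c) * length I            ≡⟨ sym (*-suc (suc (c + c)) (length I)) ⟩
          suc (c + c) * suc (length I)                    ∎
          where open ≤-Reasoning
        indep : ∀ {x y} → x ∈ u ∷ I → y ∈ u ∷ I → x ≢ y → y ∉ K x
        indep (here refl) (here refl) ne = contradiction refl ne
        indep (here refl) (there y∈) _ y∈K = proj₂ (inRest y∈) (there (∈-++⁺ˡ y∈K))
        indep (there x∈) (here refl) _ y∈K =
          proj₂ (inRest x∈) (there (∈-++⁺ʳ (K u) (∈-filter⁺ (λ v → u ∈? K v) (proj₁ (inRest x∈)) y∈K)))
        indep (there x∈) (there y∈) ne = proj₂ (proj₂ (proj₂ (proj₂ rec))) x∈ y∈ ne

unique-∷ : {A : Set} {x : A} {xs : List A} → x ∉ xs → Unique xs → Unique (x ∷ xs)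
unique-∷ x∉ u = All.tabulate (λ y∈ eq → x∉ (subst (_∈ _) (sym eq) y∈)) ∷ u

unique-head : {A : Set} {x : A} {xs : List A} → Unique (x ∷ xs) → x ∉ xs
unique-head (px ∷ _) x∈ = All.lookup px x∈ refl

unique-tail : {A : Set} {x : A} {xs : List A} → Unique (x ∷ xs) → Unique xs
unique-tail (_ ∷ u) = u

-- Hypergraphs, paths with open links, and the constants.

record Hypergraph (N : ℕ) : Set₁ where
  field
    E : Fin N → Fin N → Fin N → Set
    E? : ∀ x y z → Dec (E x y z)
    E-swapˡ : ∀ {x y z} → E x y z → E y x z
    E-swapʳ : ∀ {x y z} → E x y z → E x z y
    E-≢ : ∀ {x y z} → E x y z → x ≢ y

  E-≢ʳ : ∀ {x y z} → E x y z → y ≢ z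
  E-≢ʳ e = E-≢ (E-swapʳ (E-swapˡ e))

  E-≢ᵒ : ∀ {x y z} → E x y z → x ≢ z
  E-≢ᵒ e = E-≢ (E-swapʳ e)

-- The list of a path collects its inner vertices in order. A link given by H carries
-- no third vertex yet.
module _ {N : ℕ} (G : Hypergraph N) where
  open Hypergraph G

  data Link (H : Fin N → Fin N → Set) (u v : Fin N) : List (Fin N) → Set where
    edge : ∀ {s} → E u v s → Link H u v (s ∷ [])
    open-link : H u v → Link H u v []

  data Path (H : Fin N → Fin N → Set) : Fin N → Fin N → ℕ → List (Fin N) → Set where
    [_] : ∀ {u v xs} → Link H u v xs → Path H u v 1 xs
    _∷_ : ∀ {u w v n xs ys} → Link H u w xs → Path H w v n ys → Path H u v (suc n) (xs ++ w ∷ ys)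

  -- The empty relation excludes open links, so every link has its third vertex. The list `u ∷ ys`
  -- then holds all vertices of the cycle: `l` joints and `l` third vertices, pairwise distinct.
  LooseCycle : ℕ → Set
  LooseCycle l = ∃[ u ] ∃[ ys ] Path (λ _ _ → ⊥) u u l ys × Unique (u ∷ ys)

-- How the routes from two vertices of a level towards the root meet: at once, in a common
-- parent or in a common mate, or only further up, with mates in increasing or decreasing order.
data Meeting : ℕ → Set where
  viaParent viaMate : ∀ {i} → Meeting i
  liftUp liftDown : ∀ {i} → Meeting i → Meeting (suc i)

-- Half the number of links of the route belonging to a meeting: two links when the routes meet at
-- once, and two more for every level they climb.
half : ∀ {i} → Meeting i → ℕ
half viaParent = 1
half viaMate = 1
half (liftUp τ) = suc (half τ)
half (liftDown τ) = suc (half τ)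

half≤ : ∀ {i} (τ : Meeting i) → half τ ≤ suc i
half≤ viaParent = s≤s z≤n
half≤ viaMate = s≤s z≤n
half≤ (liftUp τ) = s≤s (half≤ τ)
half≤ (liftDown τ) = s≤s (half≤ τ)

meetings : ∀ i → List (Meeting i)
meetings zero = viaParent ∷ viaMate ∷ []
meetings (suc i) = viaParent ∷ viaMate ∷ map liftUp (meetings i) ++ map liftDown (meetings i)

∈-meetings : ∀ {i} (τ : Meeting i) → τ ∈ meetings i
∈-meetings {zero} viaParent = here refl
∈-meetings {suc i} viaParent = here refl
∈-meetings {zero} viaMate = there (here refl)
∈-meetings {suc i} viaMate = there (here refl)
∈-meetings (liftUp τ) = there (there (∈-++⁺ˡ (∈-map⁺ liftUp (∈-meetings τ))))
∈-meetings {suc i} (liftDown τ) =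
  there (there (∈-++⁺ʳ (map liftUp (meetings i)) (∈-map⁺ liftDown (∈-meetings τ))))

module Constants (l : ℕ) where

  -- `D` is the number of vertices to be avoided while a closed semi-path is filled: at most `2 * l`
  -- already present and `2 * l` in the completed path. `c` bounds the vertices avoided while a
  -- chain is built, `Q₀` is the loss of `sparse-independent` with lists of length `c`, and `Q`
  -- allows for up to `l` layers. `κ i` pays one factor `Q` for each way of meeting.
  D c Q₀ Q : ℕ
  D = 4 * l
  c = 2 * l
  Q₀ = suc (c + c)
  Q = l * Q₀

  κ : ℕ → ℕ
  κ i = Q ^ length (meetings i)

-- Reducing a level to an independent part without heavy pairs.

module Levels {N : ℕ} (G : Hypergraph N) (l : ℕ) where
  open Hypergraph G
  open Constants l public

  V : Set
  V = Fin N

  nbrs : V → V → List V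
  nbrs u v = filter (E? u v) (allFin N)

  nbrs-unique : ∀ u v → Unique (nbrs u v)
  nbrs-unique u v = Uniqueₚ.filter⁺ (E? u v) (Uniqueₚ.allFin⁺ N)

  ∈-nbrs⁺ : ∀ {u v w} → E u v w → w ∈ nbrs u v
  ∈-nbrs⁺ {u} {v} {w} = ∈-filter⁺ (E? u v) (∈-allFin w)

  ∈-nbrs⁻ : ∀ {u v w} → w ∈ nbrs u v → E u v w
  ∈-nbrs⁻ {u} {v} p = proj₂ (∈-filter⁻ (E? u v) {xs = allFin N} p)

  Heavy : V → V → Set
  Heavy u v = D < length (nbrs u v)

  heavy? : ∀ u v → Dec (Heavy u v)
  heavy? u v = D <? length (nbrs u v)

  heavy-sym : ∀ {u v} → Heavy u v → Heavy v u
  heavy-sym {u} {v} h = ≤-trans h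
    (distinct-length id (nbrs-unique u v) λ p → ∈-nbrs⁺ (E-swapˡ (∈-nbrs⁻ p)))

  heavy-fresh : ∀ {u v} → Heavy u v → ∀ Z → length Z ≤ D → ∃[ w ] E u v w × w ∉ Z
  heavy-fresh {u} {v} h Z le with fresh Z (nbrs-unique u v) (≤-<-trans le h)
  ... | w , w∈ , w∉ = w , ∈-nbrs⁻ w∈ , w∉

  SemiPath FullPath : V → V → ℕ → List V → Set
  SemiPath = Path G Heavy
  FullPath = Path G (λ _ _ → ⊥)

  append : ∀ {H u w v m n xs ys} → Path G H u w m xs → Path G H w v n ys →
           Path G H u v (m + n) (xs ++ w ∷ ys)
  append [ k ] q = k ∷ q
  append {ys = ys} (_∷_ {xs = xs} {ys = xs′} k p) q =
    subst (Path G _ _ _ _) (sym (++-assoc xs (_ ∷ xs′) (_ ∷ ys))) (k ∷ append p q)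

  path-length : ∀ {H u v n xs} → Path G H u v n xs → suc (length xs) ≤ 2 * n
  path-length [ edge _ ] = ≤-refl
  path-length [ open-link _ ] = s≤s z≤n
  path-length {n = suc n} (edge _ ∷ p) =
    ≤-trans (s≤s (s≤s (path-length p))) (≤-reflexive (sym (*-suc 2 n)))
  path-length {n = suc n} (open-link _ ∷ p) =
    ≤-trans (n≤1+n _) (≤-trans (s≤s (s≤s (path-length p))) (≤-reflexive (sym (*-suc 2 n))))

  -- Heavy links are completed one by one, each time avoiding everything used so far.
  fill : ∀ {u v n xs} → SemiPath u v n xs → ∀ Z → (∀ {x} → x ∈ xs → x ∈ Z) → Unique xs →
         length Z + 2 * n ≤ D →
         ∃[ ys ] FullPath u v n ys × Unique ys × (∀ {y} → y ∈ ys → y ∈ xs ⊎ y ∉ Z)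
  fill [ edge e ] Z sub u le = _ , [ edge e ] , u , inj₁
  fill [ open-link h ] Z sub u le with heavy-fresh h Z (≤-trans (m≤m+n _ _) le)
  ... | w , e , w∉ = w ∷ [] , [ edge e ] , [] ∷ [] , λ { (here refl) → inj₂ w∉ }
  fill {n = suc n} (_∷_ {w = w} {ys = xs} (edge {s} e) p) Z sub u le
    with fill p Z (sub ∘ there ∘ there) (unique-tail (unique-tail u))
           (≤-trans (+-monoʳ-≤ (length Z) (*-monoʳ-≤ 2 (n≤1+n n))) le)
  ... | ys , q , uy , old = s ∷ w ∷ ys , edge e ∷ q , unique-∷ s∉ (unique-∷ w∉ uy) , from
    where
    w∉ : w ∉ ys
    w∉ w∈ with old w∈
    ... | inj₁ p = unique-head (unique-tail u) p
    ... | inj₂ ne = ne (sub (there (here refl)))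
    s∉ : s ∉ w ∷ ys
    s∉ (here refl) = unique-head u (here refl)
    s∉ (there s∈) with old s∈
    ... | inj₁ p = unique-head u (there p)
    ... | inj₂ ne = ne (sub (here refl))
    from : ∀ {y} → y ∈ s ∷ w ∷ ys → y ∈ s ∷ w ∷ xs ⊎ y ∉ Z
    from (here eq) = inj₁ (here eq)
    from (there (here eq)) = inj₁ (there (here eq))
    from (there (there y∈)) with old y∈
    ... | inj₁ p = inj₁ (there (there p))
    ... | inj₂ ne = inj₂ ne
  fill {n = suc n} (_∷_ {w = w} {ys = xs} (open-link h) p) Z sub u le
    with fill p Z (sub ∘ there) (unique-tail u)
           (≤-trans (+-monoʳ-≤ (length Z) (*-monoʳ-≤ 2 (n≤1+n n))) le)
  ... | ys , q , uy , old with heavy-fresh h (Z ++ ys) (begin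
      length (Z ++ ys)          ≡⟨ length-++ Z ⟩
      length Z + length ys      ≤⟨ +-monoʳ-≤ (length Z) (≤-trans (n≤1+n _) (path-length q)) ⟩
      length Z + 2 * n          ≤⟨ +-monoʳ-≤ (length Z) (*-monoʳ-≤ 2 (n≤1+n n)) ⟩
      length Z + 2 * suc n      ≤⟨ le ⟩
      D                         ∎)
      where open ≤-Reasoning
  ... | s , e , s∉ = s ∷ w ∷ ys , edge e ∷ q , unique-∷ s∉′ (unique-∷ w∉ uy) , from
    where
    w∉ : w ∉ ys
    w∉ w∈ with old w∈
    ... | inj₁ p = unique-head u p
    ... | inj₂ ne = ne (sub (here refl))
    s∉′ : s ∉ w ∷ ys
    s∉′ (here refl) = s∉ (∈-++⁺ˡ (sub (here refl)))
    s∉′ (there s∈) = s∉ (∈-++⁺ʳ Z s∈)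
    from : ∀ {y} → y ∈ s ∷ w ∷ ys → y ∈ w ∷ xs ⊎ y ∉ Z
    from (here refl) = inj₂ (s∉ ∘ ∈-++⁺ˡ)
    from (there (here eq)) = inj₁ (here eq)
    from (there (there y∈)) with old y∈
    ... | inj₁ p = inj₁ (there p)
    ... | inj₂ ne = inj₂ ne

  -- By `path-length` the list `u ∷ xs` has at most `2 * l` entries, which leaves `2 * l` of the
  -- `D = 4 * l` available for filling.
  close : ∀ {u xs} → SemiPath u u l xs → Unique (u ∷ xs) → LooseCycle G l
  close {u} {xs} p (u≢ ∷ uxs) with fill p (u ∷ xs) there uxs
    (≤-trans (+-monoˡ-≤ (2 * l) (path-length p)) (≤-reflexive (double l)))
    where
    double : ∀ l → 2 * l + 2 * l ≡ 4 * l
    double = solve-∀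
  ... | ys , q , uy , old = u , ys , q , unique-∷ u∉ uy
    where
    u∉ : u ∉ ys
    u∉ u∈ with old u∈
    ... | inj₁ p = All.lookup u≢ p refl
    ... | inj₂ ne = ne (here refl)

  -- Any two vertices of the level L are joined by a route of even length inside U. Transitivity
  -- makes the ends of a monotone path in L meet in the same way as its consecutive vertices.
  record Level (i : ℕ) (L U : List V) : Set₁ where
    field
      R : Meeting i → V → V → Set
      R? : ∀ τ u v → Dec (R τ u v)
      R-trans : ∀ τ → Transitive (R τ)
      R-≢ : ∀ τ {u v} → R τ u v → u ≢ v
      total : ∀ {u v} → u ∈ L → v ∈ L → u ≢ v → ∃[ τ ] (R τ u v ⊎ R τ v u)
      route : ∀ τ {u v} → u ∈ L → v ∈ L → R τ u v →
              ∃[ xs ] SemiPath v u (2 * half τ) xs × Unique xs × (∀ {x} → x ∈ xs → x ∈ U)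
      disjoint : ∀ {x} → x ∈ L → x ∉ U

  module Reduce {X : Set} (found : LooseCycle G l → X) {i : ℕ} {L U : List V} (𝓛 : Level i L U) where
    open Level 𝓛

    Good : Meeting i → List V → Set
    Good τ I = ∀ {u v} → u ∈ I → v ∈ I → R τ u v → ¬ Heavy u v × (∀ {s} → s ∈ I → ¬ E u v s)

    -- The cycle is planned as a monotone chain of `suc j` links inside the level, closed by a route
    -- of `2 * half τ` links outside it.
    module OneMeeting (τ : Meeting i) (j : ℕ) (l≡ : l ≡ suc j + 2 * half τ)
                      (M : List V) (M⊆L : ∀ {x} → x ∈ M → x ∈ L) (M-unique : Unique M) where

      Out : List V → V → List V → Set
      Out A u Y = Any (λ v → R τ u v × v ∉ Y × (Heavy u v ⊎ Any (λ s → s ∉ Y × E u v s) A)) A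

      out? : ∀ A u Y → Dec (Out A u Y)
      out? A u Y = any? (λ v → R? τ u v ×-dec ¬? (v ∈? Y) ×-dec
        (heavy? u v ⊎-dec any? (λ s → ¬? (s ∈? Y) ×-dec E? u v s) A)) A

      -- A rich vertex can continue a monotone chain whatever the chain has used so far. A poor one
      -- comes with a bounded set `Y` that meets all its continuations.
      Rich : List V → V → Set
      Rich A u = ∀ Y → length Y ≤ c → Out A u Y

      Poor : List V → V → Set
      Poor A u = ∃[ Y ] length Y ≤ c × ¬ Out A u Y

      poor-or-rich : ∀ A u → Poor A u ⊎ Rich A u
      poor-or-rich A u = short-lists c (out? A u)

      rich? : ∀ A u → Dec (Rich A u)
      rich? A u with poor-or-rich A u
      ... | inj₁ (Y , le , ¬o) = no λ r → ¬o (r Y le)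
      ... | inj₂ r = yes r

      cover : List V → V → List V
      cover A u = [ proj₁ , (λ _ → []) ]′ (poor-or-rich A u)

      cover-short : ∀ A u → length (cover A u) ≤ c
      cover-short A u with poor-or-rich A u
      ... | inj₁ (Y , le , _) = le
      ... | inj₂ _ = z≤n

      cover-covers : ∀ A u → ¬ Rich A u → ¬ Out A u (cover A u)
      cover-covers A u ¬r with poor-or-rich A u
      ... | inj₁ (_ , _ , ¬o) = ¬o
      ... | inj₂ r = contradiction r ¬r

      -- Index `j` counts the links guaranteed from a vertex: each link leads from `A (suc j)` to
      -- `A j`, where the continuation is again available if `j` is positive.
      A : ℕ → List V
      A zero = M
      A (suc j) = filter (rich? (A j)) (A j)

      A⊆M : ∀ j {x} → x ∈ A j → x ∈ M
      A⊆M zero x∈ = x∈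
      A⊆M (suc j) x∈ = A⊆M j (proj₁ (∈-filter⁻ (rich? (A j)) x∈))

      A-unique : ∀ j → Unique (A j)
      A-unique zero = M-unique
      A-unique (suc j) = Uniqueₚ.filter⁺ (rich? (A j)) (A-unique j)

      Chain : ℕ → V → List V → Set
      Chain n u Y = ∃[ v ] ∃[ xs ] SemiPath u v n xs × R τ u v × Unique (v ∷ xs) ×
        (∀ {x} → x ∈ v ∷ xs → x ∈ M) × (∀ {x} → x ∈ v ∷ xs → x ∉ Y)

      -- Every link uses at most two new vertices, its end and its third vertex. They join `Y`
      -- before the recursive call, which explains the budget `length Y + 2 * j`. Transitivity
      -- carries `R τ` from the first vertex to the last.
      chain : ∀ j {u} Y → u ∈ A (suc j) → length Y + 2 * j ≤ c → Chain (suc j) u Y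
      chain j {u} Y u∈ le with find (proj₂ (∈-filter⁻ (rich? (A j)) {xs = A j} u∈) Y (≤-trans (m≤m+n _ _) le))
      chain zero Y u∈ le | v , v∈ , r , v∉ , inj₁ h =
        v , [] , [ open-link h ] , r , [] ∷ [] , (λ { (here refl) → v∈ }) , λ { (here refl) → v∉ }
      chain zero Y u∈ le | v , v∈ , r , v∉ , inj₂ as with find as
      ... | s , s∈ , s∉ , e = v , s ∷ [] , [ edge e ] , r , unique-∷ (λ { (here eq) → E-≢ʳ e eq }) ([] ∷ []) ,
        (λ { (here refl) → v∈ ; (there (here refl)) → s∈ }) , λ { (here refl) → v∉ ; (there (here refl)) → s∉ }
      chain (suc j) Y u∈ le | w , w∈ , r , w∉ , inj₁ h
        with chain j (w ∷ Y) w∈ (≤-trans (n≤1+n _) (≤-trans (≤-reflexive (lem (length Y) j)) le))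
        where
        lem : ∀ a b → suc (suc (a + 2 * b)) ≡ a + 2 * suc b
        lem = solve-∀
      ... | v , xs , p , r′ , u , inM , avoid =
        v , w ∷ xs , open-link h ∷ p , R-trans τ r r′ ,
        unique-∷ (λ { (here refl) → avoid (here refl) (here refl) ; (there q) → unique-head u q })
          (unique-∷ (λ q → avoid (there q) (here refl)) (unique-tail u)) ,
        (λ { (here refl) → inM (here refl) ; (there (here refl)) → A⊆M (suc j) w∈ ; (there (there q)) → inM (there q) }) ,
        λ { (here refl) q → avoid (here refl) (there q) ; (there (here refl)) → w∉
          ; (there (there x∈)) q → avoid (there x∈) (there q) }
      chain (suc j) Y u∈ le | w , w∈ , r , w∉ , inj₂ as with find as
      ... | s , s∈ , s∉ , e
        with chain j (s ∷ w ∷ Y) w∈ (≤-trans (≤-reflexive (lem (length Y) j)) le)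
        where
        lem : ∀ a b → suc (suc (a + 2 * b)) ≡ a + 2 * suc b
        lem = solve-∀
      ... | v , xs , p , r′ , u , inM , avoid =
        v , s ∷ w ∷ xs , edge e ∷ p , R-trans τ r r′ ,
        unique-∷ (λ { (here refl) → avoid (here refl) (here refl)
                    ; (there (here refl)) → avoid (here refl) (there (here refl))
                    ; (there (there q)) → unique-head u q })
          (unique-∷ (λ { (here refl) → E-≢ʳ e refl ; (there q) → avoid (there q) (here refl) })
            (unique-∷ (λ q → avoid (there q) (there (here refl))) (unique-tail u))) ,
        (λ { (here refl) → inM (here refl) ; (there (here refl)) → A⊆M (suc j) s∈
           ; (there (there (here refl))) → A⊆M (suc j) w∈ ; (there (there (there q))) → inM (there q) }) ,
        λ { (here refl) q → avoid (here refl) (there (there q)) ; (there (here refl)) → s∉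
          ; (there (there (here refl))) → w∉
          ; (there (there (there x∈))) q → avoid (there x∈) (there (there q)) }

      -- The chain from `u` to `v` lies in the level and the route back from `v` to `u` lies in `U`,
      -- which is disjoint from the level. So the two meet only in their ends, and their lengths add
      -- up to `l`.
      cycle : ∀ {u} → u ∈ A (suc j) → X
      cycle {u} u∈ with chain j (u ∷ []) u∈ (begin
          suc (2 * j)                   ≤⟨ n≤1+n _ ⟩
          suc (suc (2 * j))             ≡⟨ sym (*-suc 2 j) ⟩
          2 * suc j                     ≤⟨ *-monoʳ-≤ 2 (m≤m+n (suc j) (2 * half τ)) ⟩
          2 * (suc j + 2 * half τ)      ≡⟨ cong (2 *_) (sym l≡) ⟩
          c                             ∎)
        where open ≤-Reasoning
      ... | v , xs , p , r , uv ∷ uxs , inM , avoid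
        with route τ (M⊆L (A⊆M (suc j) u∈)) (M⊆L (inM (here refl))) r
      ... | zs , q , uzs , inU =
        found (close (subst (λ n → SemiPath u u n (xs ++ v ∷ zs)) (sym l≡) (append p q))
          (unique-∷ u∉ (Uniqueₚ.++⁺ uxs (unique-∷ (clash (inM (here refl))) uzs) λ { (a , b) → apart a b })))
        where
        clash : ∀ {x} → x ∈ M → x ∉ zs
        clash x∈ x∈zs = disjoint (M⊆L x∈) (inU x∈zs)
        u∉ : u ∉ xs ++ v ∷ zs
        u∉ u∈xs with ∈-++⁻ xs u∈xs
        ... | inj₁ a = avoid (there a) (here refl)
        ... | inj₂ (here refl) = avoid (here refl) (here refl)
        ... | inj₂ (there b) = clash (A⊆M (suc j) u∈) b
        apart : ∀ {x} → x ∈ xs → x ∉ v ∷ zs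
        apart x∈ (here refl) = All.lookup uv x∈ refl
        apart x∈ (there b) = clash (inM (there x∈)) b

      Reduced : (ℕ → ℕ) → Set
      Reduced f = ∃[ I ] (∀ {x} → x ∈ I → x ∈ M) × Unique I × Good τ I × length M ≤ f (length I)

      -- The poor vertices are thinned out until none lies in the cover of another. A link along `τ`
      -- inside the result would then avoid the cover of its first vertex, although that cover meets
      -- every such link.
      layer : ∀ j → ∃[ I ] (∀ {x} → x ∈ I → x ∈ M) × Unique I × Good τ I ×
                    length (filter (¬? ∘ rich? (A j)) (A j)) ≤ Q₀ * length I
      layer j with sparse-independent (cover (A j)) c (cover-short (A j))
                     (filter (¬? ∘ rich? (A j)) (A j)) (Uniqueₚ.filter⁺ (¬? ∘ rich? (A j)) (A-unique j))
      ... | I , sub , uI , bound , indep = I , A⊆M j ∘ inA , uI , good , bound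
        where
        inA : ∀ {x} → x ∈ I → x ∈ A j
        inA x∈ = proj₁ (∈-filter⁻ (¬? ∘ rich? (A j)) (sub x∈))
        covered : ∀ {x} → x ∈ I → ¬ Out (A j) x (cover (A j) x)
        covered x∈ = cover-covers (A j) _ (proj₂ (∈-filter⁻ (¬? ∘ rich? (A j)) {xs = A j} (sub x∈)))
        good : Good τ I
        good u∈ v∈ r = (λ h → covered u∈ (lose (inA v∈) (r , v∉ , inj₁ h))) ,
          λ s∈ e → covered u∈ (lose (inA v∈) (r , v∉ , inj₂ (lose (inA s∈) (indep u∈ s∈ (E-≢ᵒ e) , e))))
          where v∉ = indep u∈ v∈ (R-≢ τ r)

      -- `M` consists of `j` layers of poor vertices and the remainder `A j`. Keeping only the
      -- largest of the independent sets found bounds all layers by one size.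
      layers : ∀ j → Reduced (λ n → j * (Q₀ * n) + length (A j))
      layers zero = [] , (λ ()) , [] , (λ ()) , ≤-refl
      layers (suc j) with layers j | layer j
      ... | I , I⊆ , uI , gI , bI | J , J⊆ , uJ , gJ , bJ with ≤-total (length I) (length J)
      ...   | inj₁ I≤J = J , J⊆ , uJ , gJ , (begin
        length M
          ≤⟨ bI ⟩
        j * (Q₀ * length I) + length (A j)
          ≡⟨ cong (j * (Q₀ * length I) +_) (length-filter-split (rich? (A j)) (A j)) ⟩
        j * (Q₀ * length I) + (length (A (suc j)) + length (filter (¬? ∘ rich? (A j)) (A j)))
          ≤⟨ +-mono-≤ (*-monoʳ-≤ j (*-monoʳ-≤ Q₀ I≤J)) (+-monoʳ-≤ (length (A (suc j))) bJ) ⟩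
        j * (Q₀ * length J) + (length (A (suc j)) + Q₀ * length J)
          ≡⟨ lem (j * (Q₀ * length J)) (length (A (suc j))) (Q₀ * length J) ⟩
        Q₀ * length J + j * (Q₀ * length J) + length (A (suc j)) ∎)
        where
        open ≤-Reasoning
        lem : ∀ a b c → a + (b + c) ≡ c + a + b
        lem = solve-∀
      ...   | inj₂ J≤I = I , I⊆ , uI , gI , (begin
        length M
          ≤⟨ bI ⟩
        j * (Q₀ * length I) + length (A j)
          ≡⟨ cong (j * (Q₀ * length I) +_) (length-filter-split (rich? (A j)) (A j)) ⟩
        j * (Q₀ * length I) + (length (A (suc j)) + length (filter (¬? ∘ rich? (A j)) (A j)))
          ≤⟨ +-monoʳ-≤ (j * (Q₀ * length I)) (+-monoʳ-≤ (length (A (suc j))) (≤-trans bJ (*-monoʳ-≤ Q₀ J≤I))) ⟩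
        j * (Q₀ * length I) + (length (A (suc j)) + Q₀ * length I)
          ≡⟨ lem (j * (Q₀ * length I)) (length (A (suc j))) (Q₀ * length I) ⟩
        Q₀ * length I + j * (Q₀ * length I) + length (A (suc j)) ∎)
        where
        open ≤-Reasoning
        lem : ∀ a b c → a + (b + c) ≡ c + a + b
        lem = solve-∀

      -- A vertex that survives `suc j` rounds starts a chain that closes to a cycle. Otherwise `M`
      -- is exhausted by `suc j` layers, and `suc j ≤ l`.
      reduced : X ⊎ Reduced (Q *_)
      reduced = decide (A (suc j)) refl
        where
        decide : ∀ as → A (suc j) ≡ as → X ⊎ Reduced (Q *_)
        decide (a ∷ as) eq = inj₁ (cycle (subst (a ∈_) (sym eq) (here refl)))
        decide [] eq with layers (suc j)
        ... | I , sub , u , g , b = inj₂ (I , sub , u , g , (begin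
          length M                                          ≤⟨ b ⟩
          suc j * (Q₀ * length I) + length (A (suc j))      ≡⟨ cong (λ as → suc j * (Q₀ * length I) + length as) eq ⟩
          suc j * (Q₀ * length I) + 0                       ≡⟨ +-identityʳ _ ⟩
          suc j * (Q₀ * length I)                           ≤⟨ *-monoˡ-≤ (Q₀ * length I)
            (≤-trans (m≤m+n (suc j) (2 * half τ)) (≤-reflexive (sym l≡))) ⟩
          l * (Q₀ * length I)                               ≡⟨ sym (*-assoc l Q₀ (length I)) ⟩
          Q * length I                                      ∎))
          where open ≤-Reasoning

    -- `Good τ` passes to sublists, so the meetings can be treated one after another, each at the
    -- cost of a factor `Q`.
    reduce-list : Unique L → 2 * suc i < l → ∀ τs →
      X ⊎ (∃[ I ] (∀ {x} → x ∈ I → x ∈ L) × Unique I × (∀ {τ} → τ ∈ τs → Good τ I) ×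
                  length L ≤ Q ^ length τs * length I)
    reduce-list uL lt [] = inj₂ (L , id , uL , (λ ()) , ≤-reflexive (sym (+-identityʳ _)))
    reduce-list uL lt (τ ∷ τs) with reduce-list uL lt τs
    ... | inj₁ x = inj₁ x
    ... | inj₂ (I , sub , uI , good , b)
      with OneMeeting.reduced τ (l ∸ suc (2 * half τ)) l≡ I sub uI
      where
      -- As `half τ ≤ suc i`, the bound `2 * suc i < l` leaves at least one link for the chain.
      l≡ : l ≡ suc (l ∸ suc (2 * half τ)) + 2 * half τ
      l≡ = sym (trans (sym (+-suc (l ∸ suc (2 * half τ)) (2 * half τ)))
             (m∸n+n≡m (≤-trans (s≤s (*-monoʳ-≤ 2 (half≤ τ))) lt)))
    ...   | inj₁ x = inj₁ x
    ...   | inj₂ (J , J⊆ , uJ , g , b′) = inj₂ (J , sub ∘ J⊆ , uJ ,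
      (λ { (here refl) → g
         ; (there τ∈) u∈ v∈ r → proj₁ (good τ∈ (J⊆ u∈) (J⊆ v∈) r) ,
                                λ s∈ → proj₂ (good τ∈ (J⊆ u∈) (J⊆ v∈) r) (J⊆ s∈) }) ,
      (begin
        length L                                    ≤⟨ b ⟩
        Q ^ length τs * length I                    ≤⟨ *-monoʳ-≤ (Q ^ length τs) b′ ⟩
        Q ^ length τs * (Q * length J)              ≡⟨ lem (Q ^ length τs) Q (length J) ⟩
        Q * Q ^ length τs * length J                ∎))
      where
      open ≤-Reasoning
      lem : ∀ a b c → a * (b * c) ≡ b * a * c
      lem = solve-∀

  -- Any two different vertices of the level are comparable in some meeting, so an edge or a heavy
  -- pair inside `I` would contradict `Good` for that meeting.
  reduce : {X : Set} → (LooseCycle G l → X) → ∀ {i L U} → Level i L U → Unique L → 2 * suc i < l →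
    X ⊎ (∃[ I ] (∀ {x} → x ∈ I → x ∈ L) × Unique I × length L ≤ κ i * length I ×
         (∀ {x y} → x ∈ I → y ∈ I → ¬ Heavy x y) ×
         (∀ {x y z} → x ∈ I → y ∈ I → z ∈ I → ¬ E x y z))
  reduce found {i} 𝓛 uL lt with Reduce.reduce-list found 𝓛 uL lt (meetings i)
  ... | inj₁ x = inj₁ x
  ... | inj₂ (I , sub , uI , good , b) = inj₂ (I , sub , uI , b , light , indep)
    where
    open Level 𝓛
    indep : ∀ {x y z} → x ∈ I → y ∈ I → z ∈ I → ¬ E x y z
    indep x∈ y∈ z∈ e with total (sub x∈) (sub y∈) (E-≢ e)
    ... | τ , inj₁ r = proj₂ (good (∈-meetings τ) x∈ y∈ r) z∈ e
    ... | τ , inj₂ r = proj₂ (good (∈-meetings τ) y∈ x∈ r) z∈ (E-swapˡ e)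
    light : ∀ {x y} → x ∈ I → y ∈ I → ¬ Heavy x y
    light {x} {y} x∈ y∈ h with x ≟ᶠ y
    ... | yes refl = E-≢ (∈-nbrs⁻ (proj₁ (proj₂ (fresh [] (nbrs-unique x x) (≤-<-trans z≤n h))))) refl
    ... | no ne with total (sub x∈) (sub y∈) ne
    ...   | τ , inj₁ r = proj₁ (good (∈-meetings τ) x∈ y∈ r) h
    ...   | τ , inj₂ r = proj₁ (good (∈-meetings τ) y∈ x∈ r) (heavy-sym h)

-- Constructing the first level of the tree and passing to the next.

allPairs-lookup : {A : Set} {R : A → A → Set} → (∀ {x y} → R x y → R y x) → ∀ {xs x y} →
                  AllPairs R xs → x ∈ xs → y ∈ xs → x ≡ y ⊎ R x y
allPairs-lookup s (p ∷ ps) (here refl) (here refl) = inj₁ refl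
allPairs-lookup s (p ∷ ps) (here refl) (there y∈) = inj₂ (All.lookup p y∈)
allPairs-lookup s (p ∷ ps) (there x∈) (here refl) = inj₂ (s (All.lookup p x∈))
allPairs-lookup s (p ∷ ps) (there x∈) (there y∈) = allPairs-lookup s ps x∈ y∈

module _ {N : ℕ} {B : Set} (default : B) where

  assoc : List (Fin N × B) → Fin N → B
  assoc [] x = default
  assoc ((y , b) ∷ T) x = if does (x ≟ᶠ y) then b else assoc T x

  assoc-∈ : ∀ T {x} → x ∈ map proj₁ T → (x , assoc T x) ∈ T
  assoc-∈ ((y , b) ∷ T) {x} x∈ with x ≟ᶠ y | x∈
  ... | yes refl | _ = here refl
  ... | no ne | here eq = contradiction eq ne
  ... | no _ | there q = there (assoc-∈ T q)

module Steps {N : ℕ} (G : Hypergraph N) (l : ℕ) where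
  open Hypergraph G
  open Levels G l public

  module _ (v₀ : V) (T : List (V × V))
           (T-edge : ∀ {y z} → (y , z) ∈ T → E v₀ y z)
           (T-apart : ∀ {y z y′ z′} → (y , z) ∈ T → (y′ , z′) ∈ T → y ≢ z′)
           (T-heavy : ∀ {y y′ z} → (y , z) ∈ T → (y′ , z) ∈ T → y ≢ y′ → Heavy y z) where

    private
      m : V → V
      m = assoc v₀ T
      m∈ : ∀ {w} → w ∈ map proj₁ T → (w , m w) ∈ T
      m∈ = assoc-∈ v₀ T

    -- Leaves with different centres are joined through `v₀`, the centres serving as third vertices.
    -- The edges of two leaves with the same centre share two vertices and form no loose path; there
    -- the route runs through the centre along two heavy pairs instead.
    seed-level : Level 0 (map proj₁ T) (v₀ ∷ map proj₂ T)
    seed-level = record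
      { R = R ; R? = R? ; R-trans = R-trans ; R-≢ = R-≢
      ; total = λ {u} {v} _ _ ne → total u v ne ; route = route ; disjoint = disjoint }
      where
      R : Meeting 0 → V → V → Set
      R viaParent u v = m u Fin.< m v
      R viaMate u v = m u ≡ m v × u Fin.< v
      R? : ∀ τ u v → Dec (R τ u v)
      R? viaParent u v = m u Fin.<? m v
      R? viaMate u v = (m u ≟ᶠ m v) ×-dec (u Fin.<? v)
      R-trans : ∀ τ → Transitive (R τ)
      R-trans viaParent = <-transᶠ
      R-trans viaMate (p , q) (p′ , q′) = trans p p′ , <-transᶠ q q′
      R-≢ : ∀ τ {u v} → R τ u v → u ≢ v
      R-≢ viaParent r refl = <-irreflᶠ refl r
      R-≢ viaMate (_ , r) eq = <-irreflᶠ eq r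
      total : ∀ u v → u ≢ v → ∃[ τ ] (R τ u v ⊎ R τ v u)
      total u v ne with <-cmpᶠ (m u) (m v)
      ... | tri< p _ _ = viaParent , inj₁ p
      ... | tri> _ _ p = viaParent , inj₂ p
      ... | tri≈ _ eq _ with <-cmpᶠ u v
      ...   | tri< p _ _ = viaMate , inj₁ (eq , p)
      ...   | tri> _ _ p = viaMate , inj₂ (sym eq , p)
      ...   | tri≈ _ eq′ _ = contradiction eq′ ne
      route : ∀ τ {u v} → u ∈ map proj₁ T → v ∈ map proj₁ T → R τ u v →
              ∃[ xs ] SemiPath v u (2 * half τ) xs × Unique xs × (∀ {x} → x ∈ xs → x ∈ v₀ ∷ map proj₂ T)
      route viaParent {u} {v} u∈ v∈ r = m v ∷ v₀ ∷ m u ∷ [] ,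
        edge (E-swapˡ (T-edge (m∈ v∈))) ∷ [ edge (T-edge (m∈ u∈)) ] ,
        unique-∷ (λ { (here eq) → E-≢ᵒ (T-edge (m∈ v∈)) (sym eq)
                    ; (there (here eq)) → <-irreflᶠ (sym eq) r })
          (unique-∷ (λ { (here eq) → E-≢ᵒ (T-edge (m∈ u∈)) eq }) ([] ∷ [])) ,
        λ { (here refl) → there (∈-map⁺ proj₂ (m∈ v∈)) ; (there (here refl)) → here refl
          ; (there (there (here refl))) → there (∈-map⁺ proj₂ (m∈ u∈)) }
      route viaMate {u} {v} u∈ v∈ (eq , lt) = m v ∷ [] ,
        open-link (T-heavy (m∈ v∈) u∈′ (λ e → <-irreflᶠ (sym e) lt)) ∷
          [ open-link (heavy-sym (T-heavy u∈′ (m∈ v∈) (λ e → <-irreflᶠ e lt))) ] ,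
        [] ∷ [] , λ { (here refl) → there (∈-map⁺ proj₂ (m∈ v∈)) }
        where
        u∈′ : (u , m v) ∈ T
        u∈′ = subst (λ z → (u , z) ∈ T) eq (m∈ u∈)
      disjoint : ∀ {x} → x ∈ map proj₁ T → x ∉ v₀ ∷ map proj₂ T
      disjoint x∈ (here refl) = E-≢ (T-edge (m∈ x∈)) refl
      disjoint x∈ (there x∈′) with ∈-map⁻ proj₂ x∈′
      ... | (y , z) , t∈ , refl = T-apart (m∈ x∈) t∈ refl

  Triple : Set
  Triple = V × V × V

  mate : Triple → V
  mate (_ , _ , m) = m

  parent : Triple → V
  parent (_ , p , _) = p

  module _ {i : ℕ} {L U : List V} (𝓛 : Level i L U) (v₀ : V) (T : List Triple)
           (T-edge : ∀ {w p m} → (w , p , m) ∈ T → E w p m)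
           (T-parent : ∀ {w p m} → (w , p , m) ∈ T → p ∈ L)
           (T-new : ∀ {w p m} → (w , p , m) ∈ T → w ∉ U × w ∉ L × m ∉ U)
           (T-apart : ∀ {w p m w′ p′ m′} → (w , p , m) ∈ T → (w′ , p′ , m′) ∈ T → m ≢ w′ × m ≢ p′)
           (T-inj : ∀ {w w′ p m} → (w , p , m) ∈ T → (w′ , p , m) ∈ T → w ≡ w′) where

    private
      module 𝓛 = Level 𝓛
      p m : V → V
      p w = proj₁ (assoc (v₀ , v₀) T w)
      m w = proj₂ (assoc (v₀ , v₀) T w)
      t∈ : ∀ {w} → w ∈ map proj₁ T → (w , p w , m w) ∈ T
      t∈ = assoc-∈ (v₀ , v₀) T
      L′ = map proj₁ T
      U′ = U ++ L ++ map mate T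

    -- A triple is a child, its parent and the mate that completes their edge. Vertices with a
    -- common parent meet there, with the mates as third vertices; with a common mate the roles are
    -- exchanged; otherwise the route of the parents is prolonged. The prolonged route needs
    -- different mates, but being different is not transitive. Ordering the mates upwards or
    -- downwards is, hence `liftUp` and `liftDown`. A mate may itself lie in `L`, so it must be kept
    -- apart from all parents.
    next-level : Level (suc i) L′ U′
    next-level = record
      { R = R ; R? = R? ; R-trans = R-trans ; R-≢ = R-≢
      ; total = total ; route = route ; disjoint = disjoint }
      where
      R : Meeting (suc i) → V → V → Set
      R viaParent u v = p u ≡ p v × m u Fin.< m v
      R viaMate u v = m u ≡ m v × p u Fin.< p v
      R (liftUp τ) u v = 𝓛.R τ (p u) (p v) × m u Fin.< m v
      R (liftDown τ) u v = 𝓛.R τ (p u) (p v) × m v Fin.< m u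
      R? : ∀ τ u v → Dec (R τ u v)
      R? viaParent u v = (p u ≟ᶠ p v) ×-dec (m u Fin.<? m v)
      R? viaMate u v = (m u ≟ᶠ m v) ×-dec (p u Fin.<? p v)
      R? (liftUp τ) u v = 𝓛.R? τ (p u) (p v) ×-dec (m u Fin.<? m v)
      R? (liftDown τ) u v = 𝓛.R? τ (p u) (p v) ×-dec (m v Fin.<? m u)
      R-trans : ∀ τ → Transitive (R τ)
      R-trans viaParent (a , b) (a′ , b′) = trans a a′ , <-transᶠ b b′
      R-trans viaMate (a , b) (a′ , b′) = trans a a′ , <-transᶠ b b′
      R-trans (liftUp τ) (a , b) (a′ , b′) = 𝓛.R-trans τ a a′ , <-transᶠ b b′
      R-trans (liftDown τ) (a , b) (a′ , b′) = 𝓛.R-trans τ a a′ , <-transᶠ b′ b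
      R-≢ : ∀ τ {u v} → R τ u v → u ≢ v
      R-≢ viaParent (_ , r) refl = <-irreflᶠ refl r
      R-≢ viaMate (_ , r) refl = <-irreflᶠ refl r
      R-≢ (liftUp τ) (_ , r) refl = <-irreflᶠ refl r
      R-≢ (liftDown τ) (_ , r) refl = <-irreflᶠ refl r
      total : ∀ {u v} → u ∈ L′ → v ∈ L′ → u ≢ v → ∃[ τ ] (R τ u v ⊎ R τ v u)
      total {u} {v} u∈ v∈ ne with <-cmpᶠ (p u) (p v) | <-cmpᶠ (m u) (m v)
      ... | tri≈ _ a _ | tri< b _ _ = viaParent , inj₁ (a , b)
      ... | tri≈ _ a _ | tri> _ _ b = viaParent , inj₂ (sym a , b)
      ... | tri≈ _ a _ | tri≈ _ b _ =
        contradiction (T-inj (t∈ u∈) (subst₂ (λ x y → (v , x , y) ∈ T) (sym a) (sym b) (t∈ v∈))) ne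
      ... | tri< a _ _ | tri≈ _ b _ = viaMate , inj₁ (b , a)
      ... | tri> _ _ a | tri≈ _ b _ = viaMate , inj₂ (sym b , a)
      ... | tri< _ a _ | tri< b _ _ with 𝓛.total (T-parent (t∈ u∈)) (T-parent (t∈ v∈)) a
      ...   | τ , inj₁ r = liftUp τ , inj₁ (r , b)
      ...   | τ , inj₂ r = liftDown τ , inj₂ (r , b)
      total {u} {v} u∈ v∈ ne | tri> _ a _ | tri< b _ _ with 𝓛.total (T-parent (t∈ u∈)) (T-parent (t∈ v∈)) a
      ...   | τ , inj₁ r = liftUp τ , inj₁ (r , b)
      ...   | τ , inj₂ r = liftDown τ , inj₂ (r , b)
      total {u} {v} u∈ v∈ ne | tri< _ a _ | tri> _ _ b with 𝓛.total (T-parent (t∈ u∈)) (T-parent (t∈ v∈)) a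
      ...   | τ , inj₁ r = liftDown τ , inj₁ (r , b)
      ...   | τ , inj₂ r = liftUp τ , inj₂ (r , b)
      total {u} {v} u∈ v∈ ne | tri> _ a _ | tri> _ _ b with 𝓛.total (T-parent (t∈ u∈)) (T-parent (t∈ v∈)) a
      ...   | τ , inj₁ r = liftDown τ , inj₁ (r , b)
      ...   | τ , inj₂ r = liftUp τ , inj₂ (r , b)

      inU : ∀ {x} → x ∈ U → x ∈ U′
      inU = ∈-++⁺ˡ
      p∈ : ∀ {w} → w ∈ L′ → p w ∈ U′
      p∈ w∈ = ∈-++⁺ʳ U (∈-++⁺ˡ (T-parent (t∈ w∈)))
      m∈ : ∀ {w} → w ∈ L′ → m w ∈ U′
      m∈ w∈ = ∈-++⁺ʳ U (∈-++⁺ʳ L (∈-map⁺ mate (t∈ w∈)))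

      m≢p : ∀ {u v} → u ∈ L′ → v ∈ L′ → m u ≢ p v
      m≢p u∈ v∈ = proj₂ (T-apart (t∈ u∈) (t∈ v∈))

      Route : V → V → ℕ → Set
      Route v u n = ∃[ xs ] SemiPath v u n xs × Unique xs × (∀ {x} → x ∈ xs → x ∈ U′)

      -- The route of the parents runs inside `U`, which contains neither parents nor mates. The
      -- only possible repetitions are therefore among the two parents and the two mates: `R-≢`
      -- separates the parents, `T-apart` mates from parents, and `ne` the mates.
      lift-route : ∀ τ {u v} → u ∈ L′ → v ∈ L′ → 𝓛.R τ (p u) (p v) → m u ≢ m v → Route v u (2 * suc (half τ))
      lift-route τ {u} {v} u∈ v∈ r ne with 𝓛.route τ (T-parent (t∈ u∈)) (T-parent (t∈ v∈)) r
      ... | xs , q , uxs , xs⊆U = m v ∷ p v ∷ xs ++ p u ∷ m u ∷ [] ,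
        subst (λ n → SemiPath v u n (m v ∷ p v ∷ xs ++ p u ∷ m u ∷ [])) (lem (half τ))
          (edge (T-edge (t∈ v∈)) ∷ append q [ edge (E-swapˡ (T-edge (t∈ u∈))) ]) ,
        unique-∷ mv∉ (unique-∷ pv∉ (Uniqueₚ.++⁺ uxs
          (unique-∷ (λ { (here eq) → m≢p u∈ u∈ (sym eq) }) ([] ∷ [])) λ { (a , b) → apart a b })) ,
        within
        where
        lem : ∀ h → suc (2 * h + 1) ≡ 2 * suc h
        lem = solve-∀
        xs∌L : ∀ {x} → x ∈ L → x ∉ xs
        xs∌L x∈ x∈xs = 𝓛.disjoint x∈ (xs⊆U x∈xs)
        xs∌m : ∀ {w} → w ∈ L′ → m w ∉ xs
        xs∌m w∈ x∈xs = proj₂ (proj₂ (T-new (t∈ w∈))) (xs⊆U x∈xs)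
        apart : ∀ {x} → x ∈ xs → x ∉ p u ∷ m u ∷ []
        apart x∈ (here refl) = xs∌L (T-parent (t∈ u∈)) x∈
        apart x∈ (there (here refl)) = xs∌m u∈ x∈
        pv∉ : p v ∉ xs ++ p u ∷ m u ∷ []
        pv∉ x∈ with ∈-++⁻ xs x∈
        ... | inj₁ a = xs∌L (T-parent (t∈ v∈)) a
        ... | inj₂ (here eq) = 𝓛.R-≢ τ r (sym eq)
        ... | inj₂ (there (here eq)) = m≢p u∈ v∈ (sym eq)
        mv∉ : m v ∉ p v ∷ xs ++ p u ∷ m u ∷ []
        mv∉ (here eq) = m≢p v∈ v∈ eq
        mv∉ (there x∈) with ∈-++⁻ xs x∈
        ... | inj₁ a = xs∌m v∈ a
        ... | inj₂ (here eq) = m≢p v∈ u∈ eq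
        ... | inj₂ (there (here eq)) = ne (sym eq)
        within : ∀ {x} → x ∈ m v ∷ p v ∷ xs ++ p u ∷ m u ∷ [] → x ∈ U′
        within (here refl) = m∈ v∈
        within (there (here refl)) = p∈ v∈
        within (there (there x∈)) with ∈-++⁻ xs x∈
        ... | inj₁ a = inU (xs⊆U a)
        ... | inj₂ (here refl) = p∈ u∈
        ... | inj₂ (there (here refl)) = m∈ u∈

      route : ∀ τ {u v} → u ∈ L′ → v ∈ L′ → R τ u v → Route v u (2 * half τ)
      route viaParent {u} {v} u∈ v∈ (eq , lt) = m v ∷ p v ∷ m u ∷ [] ,
        edge (T-edge (t∈ v∈)) ∷ [ edge (subst (λ x → E x u (m u)) eq (E-swapˡ (T-edge (t∈ u∈)))) ] ,
        unique-∷ (λ { (here e) → m≢p v∈ v∈ e ; (there (here e)) → <-irreflᶠ (sym e) lt })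
          (unique-∷ (λ { (here e) → m≢p u∈ v∈ (sym e) }) ([] ∷ [])) ,
        λ { (here refl) → m∈ v∈ ; (there (here refl)) → p∈ v∈ ; (there (there (here refl))) → m∈ u∈ }
      route viaMate {u} {v} u∈ v∈ (eq , lt) = p v ∷ m v ∷ p u ∷ [] ,
        edge (E-swapʳ (T-edge (t∈ v∈))) ∷
          [ edge (subst (λ x → E x u (p u)) eq (E-swapˡ (E-swapʳ (T-edge (t∈ u∈))))) ] ,
        unique-∷ (λ { (here e) → m≢p v∈ v∈ (sym e) ; (there (here e)) → <-irreflᶠ (sym e) lt })
          (unique-∷ (λ { (here e) → m≢p v∈ u∈ e }) ([] ∷ [])) ,
        λ { (here refl) → p∈ v∈ ; (there (here refl)) → m∈ v∈ ; (there (there (here refl))) → p∈ u∈ }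
      route (liftUp τ) u∈ v∈ (r , lt) = lift-route τ u∈ v∈ r λ e → <-irreflᶠ e lt
      route (liftDown τ) u∈ v∈ (r , lt) = lift-route τ u∈ v∈ r λ e → <-irreflᶠ (sym e) lt

      disjoint : ∀ {x} → x ∈ L′ → x ∉ U′
      disjoint x∈ x∈U′ with ∈-++⁻ U x∈U′
      ... | inj₁ a = proj₁ (T-new (t∈ x∈)) a
      ... | inj₂ b with ∈-++⁻ L b
      ...   | inj₁ a = proj₁ (proj₂ (T-new (t∈ x∈))) a
      ...   | inj₂ a with ∈-map⁻ mate a
      ...     | _ , t , refl = proj₁ (T-apart t (t∈ x∈)) refl

  -- Expansion makes the next level larger.

  module Growth {X : Set} (W : List V) (B : ℕ) where

    -- Only vertices outside `I` count, so that deleting a cover of the link does not delete `I`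
    -- itself.
    Covers : List V → List V → Set
    Covers I C = ∀ {x y z} → x ∈ I → y ∈ W → z ∈ W → E x y z → (y ∈ C × y ∉ I) ⊎ (z ∈ C × z ∉ I)

    -- Expansion is stated as a continuation: a set with a small cover already leads to the goal
    -- `X`. Whether `W` expands thus never has to be decided.
    Expanding : Set
    Expanding = ∀ I C → Unique I → (∀ {x} → x ∈ I → x ∈ W) → 0 < length I →
                Covers I C → length C < B * length I → X

    module _ (expanding : Expanding) {i : ℕ} {L U : List V} (𝓛 : Level i L U)
             (I : List V) (I⊆L : ∀ {x} → x ∈ I → x ∈ L) (I⊆W : ∀ {x} → x ∈ I → x ∈ W)
             (uI : Unique I) (posI : 0 < length I)
             (light : ∀ {x y} → x ∈ I → y ∈ I → ¬ Heavy x y)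
             (indep : ∀ {x y z} → x ∈ I → y ∈ I → z ∈ I → ¬ E x y z) where

      private
        module 𝓛 = Level 𝓛

        -- Besides children and mates, the neighbours of the pair `p m` are blocked, so that the
        -- same parent and mate do not get a second child. `take D` keeps this bounded and loses
        -- nothing for a light pair. A repeated mate lies in `I`, where all pairs are light.
        used : List Triple → List V
        used [] = U ++ L
        used ((w , p , m) ∷ T) = w ∷ m ∷ take D (nbrs p m) ++ used T

        used-length : ∀ T → length (used T) ≤ length U + length L + length T * (2 + D)
        used-length [] = ≤-reflexive (trans (length-++ U) (sym (+-identityʳ _)))
        used-length ((w , p , m) ∷ T) = begin
          suc (suc (length (take D (nbrs p m) ++ used T)))
            ≡⟨ cong (suc ∘ suc) (length-++ (take D (nbrs p m))) ⟩
          suc (suc (length (take D (nbrs p m)) + length (used T)))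
            ≤⟨ s≤s (s≤s (+-mono-≤ (≤-trans (≤-reflexive (length-take D (nbrs p m))) (m⊓n≤m D _)) (used-length T))) ⟩
          suc (suc (D + (length U + length L + length T * (2 + D))))
            ≡⟨ lem D (length U + length L) (length T * (2 + D)) ⟩
          length U + length L + (2 + D + length T * (2 + D)) ∎
          where
          open ≤-Reasoning
          lem : ∀ a b c → suc (suc (a + (b + c))) ≡ b + (2 + a + c)
          lem = solve-∀

        used-base : ∀ T {x} → x ∈ U ++ L → x ∈ used T
        used-base [] x∈ = x∈
        used-base ((w , p , m) ∷ T) x∈ = there (there (∈-++⁺ʳ (take D (nbrs p m)) (used-base T x∈)))

        used-child : ∀ T {w p m} → (w , p , m) ∈ T → w ∈ used T
        used-child (_ ∷ T) (here refl) = here refl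
        used-child ((_ , p , m) ∷ T) (there t) = there (there (∈-++⁺ʳ (take D (nbrs p m)) (used-child T t)))

        used-mate : ∀ T {w p m} → (w , p , m) ∈ T → m ∈ used T
        used-mate (_ ∷ T) (here refl) = there (here refl)
        used-mate ((_ , p , m) ∷ T) (there t) = there (there (∈-++⁺ʳ (take D (nbrs p m)) (used-mate T t)))

        used-nbr : ∀ T {w p m x} → (w , p , m) ∈ T → ¬ Heavy p m → E p m x → x ∈ used T
        used-nbr ((_ , p , m) ∷ T) (here refl) ¬h e =
          there (there (∈-++⁺ˡ (subst (_ ∈_) (sym (take-all D (nbrs p m) (≮⇒≥ ¬h))) (∈-nbrs⁺ e))))
        used-nbr ((_ , p , m) ∷ T) (there t) ¬h e =
          there (there (∈-++⁺ʳ (take D (nbrs p m)) (used-nbr T t ¬h e)))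

        record Valid (t : Triple) : Set where
          constructor valid
          field
            is-edge : E (proj₁ t) (parent t) (mate t)
            parent∈ : parent t ∈ I
            child∈ : proj₁ t ∈ W
            new : proj₁ t ∉ U × proj₁ t ∉ L × mate t ∉ U
        open Valid

        Apart : Triple → Triple → Set
        Apart (w , p , m) (w′ , p′ , m′) = w ≢ w′ × m ≢ w′ × m′ ≢ w × ¬ (p ≡ p′ × m ≡ m′)

        apart-sym : ∀ {s t} → Apart s t → Apart t s
        apart-sym (a , b , c , d) = a ∘ sym , c , b , λ { (e , f) → d (sym e , sym f) }

        extension : ∀ T → (∀ {t} → t ∈ T → Valid t) → ∀ {w p m} → p ∈ I → w ∈ W → E w p m →
                    w ∉ used T → (m ∈ used T → m ∈ I) → Valid (w , p , m) × All (Apart (w , p , m)) T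
        extension T val {w} {p} {m} p∈ w∈ e w∉ m∈I =
          valid e p∈ w∈ ((λ w∈U → w∉ (used-base T (∈-++⁺ˡ w∈U))) , (λ w∈L → w∉ (used-base T (∈-++⁺ʳ U w∈L))) ,
            λ m∈U → 𝓛.disjoint (I⊆L (m∈I (used-base T (∈-++⁺ˡ m∈U)))) m∈U) ,
          All.tabulate λ {t} t∈ →
            (λ { refl → w∉ (used-child T t∈) }) ,
            (λ { refl → proj₁ (proj₂ (new (val t∈))) (I⊆L (m∈I (used-child T t∈))) }) ,
            (λ { refl → w∉ (used-mate T t∈) }) ,
            λ { (refl , refl) → w∉ (used-nbr T t∈ (light p∈ (m∈I (used-mate T t∈))) (E-swapʳ (E-swapˡ e))) }

        extend : ∀ T → (∀ {t} → t ∈ T → Valid t) → length (used T) < B * length I →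
                 X ⊎ (∃[ t ] Valid t × All (Apart t) T)
        extend T val lt with any? (λ x → any? (λ y → any? (λ z →
            E? x y z ×-dec ¬? ((y ∈? used T) ×-dec ¬? (y ∈? I)) ×-dec ¬? ((z ∈? used T) ×-dec ¬? (z ∈? I))) W) W) I
        ... | no none = inj₁ (expanding I (used T) uI I⊆W posI covers lt)
          where
          covers : Covers I (used T)
          covers {x} {y} {z} x∈ y∈ z∈ e with (y ∈? used T) ×-dec ¬? (y ∈? I) | (z ∈? used T) ×-dec ¬? (z ∈? I)
          ... | yes a | _ = inj₁ a
          ... | no _ | yes b = inj₂ b
          ... | no a | no b = contradiction (lose x∈ (lose y∈ (lose z∈ (e , a , b)))) none
        ... | yes some with find some
        ...   | x , x∈ , someʸ with find someʸ
        ...     | y , y∈ , someᶻ with find someᶻ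
        ...       | z , z∈ , e , a , b with y ∈? I
        ...         | no y∉ = inj₂ ((y , x , z) ,
                      extension T val x∈ y∈ (E-swapˡ e) (λ y∈C → a (y∈C , y∉)) inI)
          where
          inI : z ∈ used T → z ∈ I
          inI z∈C with z ∈? I
          ... | yes q = q
          ... | no q = contradiction (z∈C , q) b
        ...         | yes y∈I = inj₂ ((z , x , y) ,
                      extension T val x∈ z∈ (E-swapˡ (E-swapʳ e)) (λ z∈C → b (z∈C , z∉)) λ _ → y∈I)
          where
          z∉ : z ∉ I
          z∉ z∈I = indep x∈ y∈I z∈I e

        collect : ∀ n → length U + length L + n * (2 + D) < B * length I →
                  X ⊎ (∃[ T ] length T ≡ n × (∀ {t} → t ∈ T → Valid t) × AllPairs Apart T)
        collect zero _ = inj₂ ([] , refl , (λ ()) , [])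
        collect (suc n) lt with collect n (≤-trans (s≤s (+-monoʳ-≤ (length U + length L) (m≤n+m (n * (2 + D)) (2 + D)))) lt)
        ... | inj₁ x = inj₁ x
        ... | inj₂ (T , refl , val , ap) with extend T val (≤-trans (s≤s (≤-trans (used-length T)
              (+-monoʳ-≤ (length U + length L) (m≤n+m (length T * (2 + D)) (2 + D))))) lt)
        ...   | inj₁ x = inj₁ x
        ...   | inj₂ (t , v , a) = inj₂ (t ∷ T , refl , (λ { (here refl) → v ; (there q) → val q }) , a ∷ ap)

      -- A vertex may be collected both as a parent and as a mate. Cutting the vertices into two
      -- classes and keeping the triples with parent and mate on prescribed sides excludes this at
      -- the cost of a factor 4.
      grow : ∀ n → length U + length L + n * (2 + D) < B * length I →
        X ⊎ (∃[ L′ ] ∃[ U′ ] Level (suc i) L′ U′ × Unique L′ × (∀ {x} → x ∈ L′ → x ∈ W) ×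
             n ≤ 4 * length L′ × length U′ ≡ length U + length L + length L′)
      grow n lt with collect n lt
      ... | inj₁ x = inj₁ x
      ... | inj₂ (T₀ , refl , val₀ , ap₀) with quarter-cut parent mate T₀ (E-≢ʳ ∘ is-edge ∘ val₀)
      ...   | col , quarter = inj₂ (map proj₁ T , U ++ L ++ map mate T ,
        next-level 𝓛 (origin I posI) T (is-edge ∘ val) (I⊆L ∘ parent∈ ∘ val) (new ∘ val) apart inj ,
        AllPairsₚ.map⁺ (AllPairs.map proj₁ ap) ,
        (λ x∈ → let (t , t∈ , eq) = ∈-map⁻ proj₁ x∈ in subst (_∈ W) (sym eq) (child∈ (val t∈))) ,
        subst (λ n → length T₀ ≤ 4 * n) (sym (length-map proj₁ T)) quarter ,
        sizes)
        where
        origin : ∀ I → 0 < length I → V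
        origin (x ∷ _) _ = x
        T = filter (cut? parent mate col) T₀
        ap : AllPairs Apart T
        ap = AllPairsₚ.filter⁺ (cut? parent mate col) ap₀
        T∈ : ∀ {t} → t ∈ T → t ∈ T₀ × col (parent t) ≡ true × col (mate t) ≡ false
        T∈ = ∈-filter⁻ (cut? parent mate col)
        val : ∀ {t} → t ∈ T → Valid t
        val t∈ = val₀ (proj₁ (T∈ t∈))
        apart : ∀ {w p m w′ p′ m′} → (w , p , m) ∈ T → (w′ , p′ , m′) ∈ T → m ≢ w′ × m ≢ p′
        apart s∈ t∈ = child (allPairs-lookup (λ {s} {t} → apart-sym {s} {t}) ap s∈ t∈) ,
          λ { refl → case (trans (sym (proj₁ (proj₂ (T∈ t∈)))) (proj₂ (proj₂ (T∈ s∈)))) }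
          where
          child : _ → _
          child (inj₁ refl) eq = E-≢ᵒ (is-edge (val s∈)) (sym eq)
          child (inj₂ (_ , ne , _)) = ne
          case : true ≢ false
          case ()
        inj : ∀ {w w′ p m} → (w , p , m) ∈ T → (w′ , p , m) ∈ T → w ≡ w′
        inj s∈ t∈ with allPairs-lookup (λ {s} {t} → apart-sym {s} {t}) ap s∈ t∈
        ... | inj₁ refl = refl
        ... | inj₂ (_ , _ , _ , ne) = contradiction (refl , refl) ne
        sizes : length (U ++ L ++ map mate T) ≡ length U + length L + length (map proj₁ T)
        sizes = begin
          length (U ++ L ++ map mate T)
            ≡⟨ length-++ U ⟩
          length U + length (L ++ map mate T)
            ≡⟨ cong (length U +_) (length-++ L) ⟩
          length U + (length L + length (map mate T))
            ≡⟨ sym (+-assoc (length U) (length L) _) ⟩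
          length U + length L + length (map mate T)
            ≡⟨ cong (length U + length L +_) (trans (length-map mate T) (sym (length-map proj₁ T))) ⟩
          length U + length L + length (map proj₁ T) ∎
          where open ≡-Reasoning

-- Assigning edges to pairs of small codegree.

length-filter-filter : {A : Set} {P Q R : A → Set} (P? : ∀ x → Dec (P x)) (Q? : ∀ x → Dec (Q x))
  (R? : ∀ x → Dec (R x)) → (∀ {x} → P x → Q x → R x) → ∀ xs →
  length (filter P? (filter Q? xs)) ≤ length (filter R? xs)
length-filter-filter P? Q? R? h [] = z≤n
length-filter-filter P? Q? R? h (x ∷ xs) with Q? x
... | no _ with R? x
...   | yes _ = m≤n⇒m≤1+n (length-filter-filter P? Q? R? h xs)
...   | no _ = length-filter-filter P? Q? R? h xs
length-filter-filter P? Q? R? h (x ∷ xs) | yes q with P? x | R? x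
...   | yes p | yes _ = s≤s (length-filter-filter P? Q? R? h xs)
...   | yes p | no ¬r = contradiction (h p q) ¬r
...   | no _ | yes _ = m≤n⇒m≤1+n (length-filter-filter P? Q? R? h xs)
...   | no _ | no _ = length-filter-filter P? Q? R? h xs

length-filter-map : {A B : Set} {P : B → Set} {Q : A → Set} (P? : ∀ x → Dec (P x)) (Q? : ∀ x → Dec (Q x))
  (f : A → B) → (∀ {x} → P (f x) → Q x) → ∀ xs → length (filter P? (map f xs)) ≤ length (filter Q? xs)
length-filter-map P? Q? f h [] = z≤n
length-filter-map P? Q? f h (x ∷ xs) with P? (f x) | Q? x
... | yes p | yes _ = s≤s (length-filter-map P? Q? f h xs)
... | yes p | no ¬q = contradiction (h p) ¬q
... | no _ | yes _ = m≤n⇒m≤1+n (length-filter-map P? Q? f h xs)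
... | no _ | no _ = length-filter-map P? Q? f h xs

length-filter-sum : {A : Set} {P : A → Set} (P? : ∀ x → Dec (P x)) (f : A → ℕ) →
  (∀ {x} → P x → 0 < f x) → ∀ xs → length (filter P? xs) ≤ sum (map f xs)
length-filter-sum P? f h [] = z≤n
length-filter-sum P? f h (x ∷ xs) with P? x
... | yes p = +-mono-≤ (h p) (length-filter-sum P? f h xs)
... | no _ = ≤-trans (length-filter-sum P? f h xs) (m≤n+m _ (f x))

allPairs-map∈ : {A : Set} {R S : A → A → Set} {xs : List A} →
  (∀ {x y} → x ∈ xs → y ∈ xs → R x y → S x y) → AllPairs R xs → AllPairs S xs
allPairs-map∈ h [] = []
allPairs-map∈ h (p ∷ ps) = All.tabulate (λ y∈ → h (here refl) (there y∈) (All.lookup p y∈)) ∷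
  allPairs-map∈ (λ x∈ y∈ → h (there x∈) (there y∈)) ps

module Triples (N : ℕ) where

  private
    V = Fin N
    Triple = V × V × V

  elems : Triple → List V
  elems (a , b , c) = a ∷ b ∷ c ∷ []

  data _≈_ : Triple → Triple → Set where
    ≈-refl : ∀ {t} → t ≈ t
    swapˡ : ∀ {a b c t} → (b , a , c) ≈ t → (a , b , c) ≈ t
    swapʳ : ∀ {a b c t} → (a , c , b) ≈ t → (a , b , c) ≈ t

  ≈-trans : ∀ {s t u} → s ≈ t → t ≈ u → s ≈ u
  ≈-trans ≈-refl q = q
  ≈-trans (swapˡ p) q = swapˡ (≈-trans p q)
  ≈-trans (swapʳ p) q = swapʳ (≈-trans p q)

  elems-≈ : ∀ {s t x} → s ≈ t → x ∈ elems s → x ∈ elems t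
  elems-≈ ≈-refl x∈ = x∈
  elems-≈ (swapˡ p) (here e) = elems-≈ p (there (here e))
  elems-≈ (swapˡ p) (there (here e)) = elems-≈ p (here e)
  elems-≈ (swapˡ p) (there (there x∈)) = elems-≈ p (there (there x∈))
  elems-≈ (swapʳ p) (here e) = elems-≈ p (here e)
  elems-≈ (swapʳ p) (there (here e)) = elems-≈ p (there (there (here e)))
  elems-≈ (swapʳ p) (there (there (here e))) = elems-≈ p (there (here e))

  ≈-sym : ∀ {s t} → s ≈ t → t ≈ s
  ≈-sym ≈-refl = ≈-refl
  ≈-sym (swapˡ p) = ≈-trans (≈-sym p) (swapˡ ≈-refl)
  ≈-sym (swapʳ p) = ≈-trans (≈-sym p) (swapʳ ≈-refl)

  Closed : List Triple → Set
  Closed F = ∀ {s t} → s ≈ t → s ∈ F → t ∈ F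

  isolate : ∀ {x y t} → x ≢ y → x ∈ elems t → y ∈ elems t → ∃[ w ] t ≈ (x , y , w)
  isolate ne (here refl) (here refl) = contradiction refl ne
  isolate ne (here refl) (there (here refl)) = _ , ≈-refl
  isolate ne (here refl) (there (there (here refl))) = _ , swapʳ ≈-refl
  isolate ne (there (here refl)) (here refl) = _ , swapˡ ≈-refl
  isolate ne (there (here refl)) (there (here refl)) = contradiction refl ne
  isolate ne (there (here refl)) (there (there (here refl))) = _ , swapˡ (swapʳ ≈-refl)
  isolate ne (there (there (here refl))) (here refl) = _ , swapʳ (swapˡ ≈-refl)
  isolate ne (there (there (here refl))) (there (here refl)) = _ , swapʳ (swapˡ (swapʳ ≈-refl))
  isolate ne (there (there (here refl))) (there (there (here refl))) = contradiction refl ne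

module Counting {N : ℕ} (G : Hypergraph N) (l : ℕ) {X : Set} (found : LooseCycle G l → X)
                (3≤l : 3 ≤ l) (W : List (Fin N)) (uW : Unique W) where
  open Hypergraph G
  open Steps G l
  open Triples N

  _≟₃_ : (s t : Triple) → Dec (s ≡ t)
  _≟₃_ = ×-≡-dec _≟ᶠ_ (×-≡-dec _≟ᶠ_ _≟ᶠ_)

  HasPair : V → V → Triple → Set
  HasPair x y (a , b , _) = (a ≡ x × b ≡ y) ⊎ (a ≡ y × b ≡ x)

  hasPair? : ∀ x y t → Dec (HasPair x y t)
  hasPair? x y (a , b , _) = ((a ≟ᶠ x) ×-dec (b ≟ᶠ y)) ⊎-dec ((a ≟ᶠ y) ×-dec (b ≟ᶠ x))

  thirds : List Triple → V → V → List V
  thirds F x y = filter (λ w → mem? _≟₃_ (x , y , w) F) W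

  record EdgeSet (F : List Triple) : Set where
    field
      closed : Closed F
      edges : ∀ {x y z} → (x , y , z) ∈ F → E x y z
      within-W : ∀ {t x} → t ∈ F → x ∈ elems t → x ∈ W
  open EdgeSet

  -- Each pair of an edge can be replaced by the other two pairs of a second edge through it.
  module Unfold (F : List Triple) (es : EdgeSet F)
                (dense : ∀ {x y z} → (x , y , z) ∈ F → D < length (thirds F x y)) where

    dense⇒heavy : ∀ {x y z} → (x , y , z) ∈ F → Heavy x y
    dense⇒heavy {x} {y} t∈ = ≤-trans (dense t∈)
      (distinct-length id (Uniqueₚ.filter⁺ (λ w → mem? _≟₃_ (x , y , w) F) uW)
        λ w∈ → ∈-nbrs⁺ (edges es (proj₂ (∈-filter⁻ (λ w → mem? _≟₃_ (x , y , w) F) {xs = W} w∈))))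

    unfold : ∀ n {x y z} Z → (x , y , z) ∈ F → length Z + n ≤ D →
             ∃[ xs ] SemiPath x y (suc n) xs × Unique xs × (∀ {a} → a ∈ xs → a ∉ Z)
    unfold zero Z t∈ le = [] , [ open-link (dense⇒heavy t∈) ] , [] , λ ()
    unfold (suc n) {x} {y} Z t∈ le
      with fresh Z (Uniqueₚ.filter⁺ (λ w → mem? _≟₃_ (x , y , w) F) uW) (≤-<-trans (≤-trans (m≤m+n _ _) le) (dense t∈))
    ... | w , w∈ , w∉ with proj₂ (∈-filter⁻ (λ w → mem? _≟₃_ (x , y , w) F) {xs = W} w∈)
    ...   | s∈ with unfold n (w ∷ Z) (closed es (swapˡ (swapʳ (swapˡ ≈-refl))) s∈)
                      (≤-trans (≤-reflexive (sym (+-suc (length Z) n))) le)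
    ...     | xs , p , u , avoid = w ∷ xs ,
      open-link (dense⇒heavy (closed es (swapʳ ≈-refl) s∈)) ∷ p ,
      unique-∷ (λ w∈xs → avoid w∈xs (here refl)) u ,
      λ { (here refl) → w∉ ; (there a∈) q → avoid a∈ (there q) }

    cycle : ∀ {t} → t ∈ F → X
    cycle {x , y , z} t∈ = go l 3≤l refl
      where
      go : ∀ k → 3 ≤ k → l ≡ k → X
      go (suc zero) (s≤s ()) _
      -- The pair `x y` is itself one heavy link; unfolding it in the other direction provides the
      -- remaining `suc n = l − 1` links.
      go (suc (suc n)) _ eq with unfold n (x ∷ y ∷ []) (closed es (swapˡ ≈-refl) t∈)
        (≤-trans (≤-reflexive (sym eq)) (m≤n*m l 4))
      ... | xs , p , u , avoid =
        found (close (subst (λ k → SemiPath x x k (y ∷ xs)) (sym eq) (open-link (dense⇒heavy t∈) ∷ p))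
          (unique-∷ (λ { (here e) → E-≢ (edges es t∈) e ; (there x∈) → avoid x∈ (here refl) })
            (unique-∷ (λ y∈ → avoid y∈ (there (here refl))) u)))

  -- The first two entries of a triple in `S` name the pair to which its edge is assigned.
  Assignment : List Triple → Set
  Assignment F = ∃[ S ] (∀ {t} → t ∈ S → t ∈ F) × (∀ {t} → t ∈ F → ∃[ s ] s ∈ S × t ≈ s) ×
                        (∀ x y → length (filter (hasPair? x y) S) ≤ D)

  -- Unless all pairs are dense, some pair has at most `D` edges left. All of them are assigned to
  -- it and removed together, so the pair never occurs again and its bound is final.
  peel : ∀ fuel F → length F ≤ fuel → EdgeSet F → X ⊎ Assignment F
  peel _ [] _ _ = inj₂ ([] , (λ ()) , (λ ()) , λ _ _ → z≤n)
  peel (suc fuel) F@(_ ∷ _) le es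
    with any? (λ { (x , y , _) → length (thirds F x y) ≤? D }) F
  ... | no none = inj₁ (Unfold.cycle F es (λ t∈ → ≰⇒> λ q → none (lose t∈ q)) (here refl))
  ... | yes some with find some
  ...   | (x , y , z) , t∈ , few with peel fuel F′
            (≤-pred (≤-trans (filter-notAll keep? F (lose t∈ λ k → k (here refl , there (here refl)))) le)) es′
    where
    keep? : ∀ t → Dec (¬ (x ∈ elems t × y ∈ elems t))
    keep? t = ¬? ((x ∈? elems t) ×-dec (y ∈? elems t))
    F′ = filter keep? F
    es′ : EdgeSet F′
    es′ = record
      { closed = λ st s∈ → let s∈F , k = ∈-filter⁻ keep? {xs = F} s∈ in
          ∈-filter⁺ keep? (closed es st s∈F) λ { (a , b) → k (elems-≈ (≈-sym st) a , elems-≈ (≈-sym st) b) }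
      ; edges = λ s∈ → edges es (proj₁ (∈-filter⁻ keep? s∈))
      ; within-W = λ s∈ → within-W es (proj₁ (∈-filter⁻ keep? s∈)) }
  ...     | inj₁ r = inj₁ r
  ...     | inj₂ (S , S⊆ , onto , bound) = inj₂ (new ++ S , sub , onto′ , bound′)
    where
    keep? : ∀ t → Dec (¬ (x ∈ elems t × y ∈ elems t))
    keep? t = ¬? ((x ∈? elems t) ×-dec (y ∈? elems t))
    new = map (λ w → (x , y , w)) (thirds F x y)
    new∈ : ∀ {s} → s ∈ new → ∃[ w ] s ≡ (x , y , w) × (x , y , w) ∈ F
    new∈ s∈ with ∈-map⁻ (λ w → (x , y , w)) s∈
    ... | w , w∈ , eq = w , eq , proj₂ (∈-filter⁻ (λ w → mem? _≟₃_ (x , y , w) F) {xs = W} w∈)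
    sub : ∀ {s} → s ∈ new ++ S → s ∈ F
    sub s∈ with ∈-++⁻ new s∈
    ... | inj₁ a = let _ , eq , q = new∈ a in subst (_∈ F) (sym eq) q
    ... | inj₂ b = proj₁ (∈-filter⁻ keep? (S⊆ b))
    onto′ : ∀ {t} → t ∈ F → ∃[ s ] s ∈ new ++ S × t ≈ s
    onto′ {t} t∈F with (x ∈? elems t) ×-dec (y ∈? elems t)
    ... | no k = let s , s∈ , p = onto (∈-filter⁺ keep? t∈F k) in s , ∈-++⁺ʳ new s∈ , p
    ... | yes (a , b) with isolate (E-≢ (edges es t∈)) a b
    ...   | w , p = (x , y , w) , ∈-++⁺ˡ (∈-map⁺ _ (∈-filter⁺ (λ w → mem? _≟₃_ (x , y , w) F)
              (within-W es (closed es p t∈F) (there (there (here refl)))) (closed es p t∈F))) , p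
    both : ∀ {u v} s → HasPair u v (x , y , z) → HasPair u v s → x ∈ elems s × y ∈ elems s
    both s (inj₁ (refl , refl)) (inj₁ (refl , refl)) = here refl , there (here refl)
    both s (inj₁ (refl , refl)) (inj₂ (refl , refl)) = there (here refl) , here refl
    both s (inj₂ (refl , refl)) (inj₁ (refl , refl)) = there (here refl) , here refl
    both s (inj₂ (refl , refl)) (inj₂ (refl , refl)) = here refl , there (here refl)
    bound′ : ∀ u v → length (filter (hasPair? u v) (new ++ S)) ≤ D
    bound′ u v rewrite filter-++ (hasPair? u v) new S | length-++ (filter (hasPair? u v) new) {filter (hasPair? u v) S}
      with hasPair? u v (x , y , z)
    ... | yes h rewrite filter-none (hasPair? u v) {S} (All.tabulate λ {s} s∈ hs →
            proj₂ (∈-filter⁻ keep? {xs = F} (S⊆ s∈)) (both s h hs)) =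
      ≤-trans (≤-reflexive (+-identityʳ _)) (≤-trans (length-filter (hasPair? u v) new)
        (≤-trans (≤-reflexive (length-map _ (thirds F x y))) few))
    ... | no ¬h rewrite filter-none (hasPair? u v) {new} (All.tabulate λ s∈ hs →
            ¬h (subst (HasPair u v) (proj₁ (proj₂ (new∈ s∈))) hs)) = bound u v

  Covering : List Triple → Set
  Covering S = ∀ {x y z} → x ∈ W → y ∈ W → z ∈ W → E x y z → ∃[ s ] s ∈ S × (x , y , z) ≈ s

  -- A triple (v , y , z) of the list is an edge seen from v, with leaf y and centre z.
  record Views (S : List Triple) : Set where
    field
      view-edge : ∀ {v y z} → (v , y , z) ∈ S → E v y z
      leaf∈W : ∀ {v y z} → (v , y , z) ∈ S → y ∈ W
      view-kind : ∀ {v y z} → (v , y , z) ∈ S → ¬ Heavy v z ⊎ Heavy y z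
      view-few : ∀ v y → length (filter (λ { (v′ , y′ , _) → (v′ ≟ᶠ v) ×-dec (y′ ≟ᶠ y) }) S) ≤ D
      view-all : Covering S

  -- An edge assigned to `x y` may be viewed from either end. The choice makes the leaf and the
  -- centre a heavy pair if `x z` is heavy, and makes the root and the centre a light pair
  -- otherwise.
  orient : Triple → Triple
  orient (x , y , z) with heavy? x z
  ... | yes _ = y , x , z
  ... | no _ = x , y , z

  orient-≈ : ∀ t → t ≈ orient t
  orient-≈ (x , y , z) with heavy? x z
  ... | yes _ = swapˡ ≈-refl
  ... | no _ = ≈-refl

  orient-pair : ∀ {t v y z} → orient t ≡ (v , y , z) → HasPair v y t × (¬ Heavy v z ⊎ Heavy y z)
  orient-pair {a , b , c} eq with heavy? a c
  orient-pair {a , b , c} refl | yes h = inj₂ (refl , refl) , inj₂ h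
  orient-pair {a , b , c} refl | no ¬h = inj₁ (refl , refl) , inj₁ ¬h

  private
    isEdge? : (t : Triple) → Dec (E (proj₁ t) (proj₁ (proj₂ t)) (proj₂ (proj₂ t)))
    isEdge? (x , y , z) = E? x y z

    F₀ : List Triple
    F₀ = filter isEdge? (cartesianProduct W (cartesianProduct W W))

    F₀⁻ : ∀ {x y z} → (x , y , z) ∈ F₀ → E x y z × x ∈ W × y ∈ W × z ∈ W
    F₀⁻ t∈ with ∈-filter⁻ isEdge? {xs = cartesianProduct W (cartesianProduct W W)} t∈
    ... | p , e with ∈-cartesianProduct⁻ W (cartesianProduct W W) p
    ...   | x∈ , q with ∈-cartesianProduct⁻ W W q
    ...     | y∈ , z∈ = e , x∈ , y∈ , z∈

    F₀⁺ : ∀ {x y z} → E x y z → x ∈ W → y ∈ W → z ∈ W → (x , y , z) ∈ F₀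
    F₀⁺ e x∈ y∈ z∈ = ∈-filter⁺ isEdge? (∈-cartesianProduct⁺ x∈ (∈-cartesianProduct⁺ y∈ z∈)) e

    F₀-closed : Closed F₀
    F₀-closed ≈-refl s∈ = s∈
    F₀-closed (swapˡ p) s∈ = let e , x∈ , y∈ , z∈ = F₀⁻ s∈ in F₀-closed p (F₀⁺ (E-swapˡ e) y∈ x∈ z∈)
    F₀-closed (swapʳ p) s∈ = let e , x∈ , y∈ , z∈ = F₀⁻ s∈ in F₀-closed p (F₀⁺ (E-swapʳ e) x∈ z∈ y∈)

    F₀-edges : EdgeSet F₀
    F₀-edges = record
      { closed = F₀-closed
      ; edges = proj₁ ∘ F₀⁻
      ; within-W = λ { t∈ (here refl) → proj₁ (proj₂ (F₀⁻ t∈))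
                   ; t∈ (there (here refl)) → proj₁ (proj₂ (proj₂ (F₀⁻ t∈)))
                   ; t∈ (there (there (here refl))) → proj₂ (proj₂ (proj₂ (F₀⁻ t∈))) } }

  views : X ⊎ ∃ Views
  views with peel (length F₀) F₀ ≤-refl F₀-edges
  ... | inj₁ r = inj₁ r
  ... | inj₂ (S , S⊆ , onto , few) = inj₂ (map orient S , record
    { view-edge = proj₁ ∘ F₀⁻ ∘ inF
    ; leaf∈W = proj₁ ∘ proj₂ ∘ proj₂ ∘ F₀⁻ ∘ inF
    ; view-kind = λ t∈ → let t , _ , eq = ∈-map⁻ orient t∈ in proj₂ (orient-pair {t} (sym eq))
    ; view-few = λ v y → ≤-trans (length-filter-map _ (hasPair? v y) orient
        (λ { {t} (refl , refl) → proj₁ (orient-pair {t} refl) }) S) (few v y)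
    ; view-all = λ x∈ y∈ z∈ e → let s , s∈ , p = onto (F₀⁺ e x∈ y∈ z∈) in
        orient s , ∈-map⁺ orient s∈ , ≈-trans p (orient-≈ s) })
    where
    inF : ∀ {t} → t ∈ map orient S → t ∈ F₀
    inF t∈ with ∈-map⁻ orient t∈
    ... | s , s∈ , refl = F₀-closed (orient-≈ s) (S⊆ s∈)

  -- A vertex with many views is the root of a tree.

  module Seed (S : List Triple) (vw : Views S) (v : V) where
    open Views vw

    leaf centre : Triple → V
    leaf = parent
    centre = mate

    own? : (t : Triple) → Dec (proj₁ t ≡ v)
    own? t = proj₁ t ≟ᶠ v

    Fit : List Triple → Set
    Fit Z = Distinct leaf Z × (∀ {s t} → s ∈ Z → t ∈ Z → leaf s ≢ leaf t → centre s ≡ centre t → Heavy (leaf s) (centre s))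

    private
      T₀ = filter own? S
      T₀∈ : ∀ {t} → t ∈ T₀ → t ∈ S × proj₁ t ≡ v
      T₀∈ = ∈-filter⁻ own?

    -- After making the leaves distinct, views whose leaf and centre are heavy may share centres.
    -- For the others the root and the centre form a light pair, so at most `D` leaves share a
    -- centre and the centres can be made distinct too. The larger of the two kinds is kept.
    fit : ∃[ Z ] (∀ {t} → t ∈ Z → t ∈ S × proj₁ t ≡ v) × Fit Z × length T₀ ≤ D * (suc D * length Z)
    fit with select-distinct leaf D T₀ (λ y → ≤-trans
               (length-filter-filter _ own? _ (λ p q → q , p) S) (view-few v y))
    ... | T₁ , T₁⊆ , dist₁ , b₁
      with select-distinct centre D Lt few
      where
      hv? : ∀ t → Dec (Heavy (leaf t) (centre t))
      hv? t = heavy? (leaf t) (centre t)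
      Lt = filter (¬? ∘ hv?) T₁
      few : ∀ z → length (filter (λ t → centre t ≟ᶠ z) Lt) ≤ D
      few z = at-most (filter (λ t → centre t ≟ᶠ z) Lt)
        (AllPairsₚ.filter⁺ (λ t → centre t ≟ᶠ z) (AllPairsₚ.filter⁺ (¬? ∘ hv?) dist₁))
        (λ t∈ → let p , eq = ∈-filter⁻ (λ t → centre t ≟ᶠ z) {xs = Lt} t∈
                    q , ¬h = ∈-filter⁻ (¬? ∘ hv?) {xs = T₁} p in q , ¬h , eq)
        where
        at-most : ∀ K → Distinct leaf K → (∀ {t} → t ∈ K → t ∈ T₁ × ¬ Heavy (leaf t) (centre t) × centre t ≡ z) →
                  length K ≤ D
        at-most [] _ _ = z≤n
        at-most K@(k ∷ _) dist h = ≤-trans (distinct-length leaf dist leaves) light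
          where
          leaves : ∀ {t} → t ∈ K → leaf t ∈ nbrs v z
          leaves t∈ with h t∈
          ... | q , _ , refl with T₀∈ (T₁⊆ q)
          ...   | s∈ , refl = ∈-nbrs⁺ (E-swapʳ (view-edge s∈))
          light : length (nbrs v z) ≤ D
          light with h (here refl)
          ... | q , ¬h , refl with T₀∈ (T₁⊆ q)
          ...   | s∈ , refl with view-kind s∈
          ...     | inj₁ ¬hv = ≮⇒≥ ¬hv
          ...     | inj₂ hyz = contradiction hyz ¬h
    ... | Lt , Lt⊆ , dist₂ , b₂ with ≤-total (length (filter (λ t → heavy? (leaf t) (centre t)) T₁)) (length Lt)
    ...   | inj₁ le = Lt , (λ t∈ → T₀∈ (T₁⊆ (inT₁ t∈))) ,
      (allPairs-map∈ (λ s∈ t∈ ne → [ (λ e → contradiction (cong centre e) ne) , id ]′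
        (allPairs-lookup (λ ne e → ne (sym e)) dist₁ (inT₁ s∈) (inT₁ t∈))) dist₂ ,
       λ s∈ t∈ ne eq → [ (λ e → contradiction (cong leaf e) ne) , contradiction eq ]′
        (allPairs-lookup (λ ne e → ne (sym e)) dist₂ s∈ t∈)) ,
      ≤-trans b₁ (*-monoʳ-≤ D (≤-trans (≤-reflexive (length-filter-split (λ t → heavy? (leaf t) (centre t)) T₁))
        (+-mono-≤ le b₂)))
      where
      inT₁ : ∀ {t} → t ∈ Lt → t ∈ T₁
      inT₁ t∈ = proj₁ (∈-filter⁻ (¬? ∘ (λ t → heavy? (leaf t) (centre t))) (Lt⊆ t∈))
    ...   | inj₂ le = Hv , (λ t∈ → T₀∈ (T₁⊆ (proj₁ (Hv∈ t∈)))) ,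
      (AllPairsₚ.filter⁺ (λ t → heavy? (leaf t) (centre t)) dist₁ , λ s∈ _ _ _ → proj₂ (Hv∈ s∈)) ,
      ≤-trans b₁ (*-monoʳ-≤ D (≤-trans (≤-reflexive (length-filter-split (λ t → heavy? (leaf t) (centre t)) T₁))
        (+-monoʳ-≤ (length Hv) (≤-trans b₂ (*-monoʳ-≤ D le)))))
      where
      Hv = filter (λ t → heavy? (leaf t) (centre t)) T₁
      Hv∈ : ∀ {t} → t ∈ Hv → t ∈ T₁ × Heavy (leaf t) (centre t)
      Hv∈ = ∈-filter⁻ (λ t → heavy? (leaf t) (centre t)) {xs = T₁}

    -- The cut puts leaves and centres into different classes, so that no leaf is the centre of
    -- another view.
    seed : ∃[ L ] ∃[ U ] Level 0 L U × Unique L × (∀ {x} → x ∈ L → x ∈ W) ×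
           length T₀ ≤ D * (suc D * (4 * length L)) × length U ≡ suc (length L)
    seed with fit
    ... | Z , Z∈ , (dist , heavy) , b
      with quarter-cut leaf centre Z (λ t∈ → E-≢ʳ (view-edge (proj₁ (Z∈ t∈))))
    ...   | col , quarter = map proj₁ T , v ∷ map proj₂ T ,
      seed-level v T T-edge T-apart T-heavy ,
      AllPairsₚ.map⁺ (AllPairsₚ.map⁺ (AllPairsₚ.filter⁺ (cut? leaf centre col) dist)) ,
      inW ,
      ≤-trans b (*-monoʳ-≤ D (*-monoʳ-≤ (suc D) (subst (λ n → length Z ≤ 4 * n)
        (sym (trans (length-map proj₁ T) (length-map proj₂ Z′))) quarter))) ,
      cong suc (trans (length-map proj₂ T) (sym (length-map proj₁ T)))
      where
      Z′ = filter (cut? leaf centre col) Z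
      T : List (V × V)
      T = map proj₂ Z′
      T∈ : ∀ {y z} → (y , z) ∈ T → (v , y , z) ∈ Z × col y ≡ true × col z ≡ false
      T∈ p with ∈-map⁻ proj₂ p
      ... | (v′ , _) , t∈ , refl with ∈-filter⁻ (cut? leaf centre col) {xs = Z} t∈
      ...   | q , c with proj₂ (Z∈ q)
      ...     | refl = q , c
      T-edge : ∀ {y z} → (y , z) ∈ T → E v y z
      T-edge p = view-edge (proj₁ (Z∈ (proj₁ (T∈ p))))
      T-apart : ∀ {y z y′ z′} → (y , z) ∈ T → (y′ , z′) ∈ T → y ≢ z′
      T-apart p q refl with trans (sym (proj₁ (proj₂ (T∈ p)))) (proj₂ (proj₂ (T∈ q)))
      ... | ()
      T-heavy : ∀ {y y′ z} → (y , z) ∈ T → (y′ , z) ∈ T → y ≢ y′ → Heavy y z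
      T-heavy p q ne = heavy (proj₁ (T∈ p)) (proj₁ (T∈ q)) ne refl
      inW : ∀ {x} → x ∈ map proj₁ T → x ∈ W
      inW x∈ with ∈-map⁻ proj₁ x∈
      ... | (y , z) , p , refl = leaf∈W (proj₁ (Z∈ (proj₁ (T∈ p))))

  -- Greedy independent sets when every vertex has few views.

  module Turán (S : List Triple) (covering : Covering S) (a d n : ℕ) (0<d : 0 < d) (0<n : 0 < n)
               (few : ∀ v → length (filter (λ t → proj₁ t ≟ᶠ v) S) ≤ a * (d * d))
               (large : n * (1 + 12 * (a * d)) + 12 * (n * d) ≤ length W) where

    -- `Γ` is the trace of `I` on `R`: it contains every edge with one vertex in `I` and two in `R`,
    -- so it acts as a graph on `R` whose neighbourhoods must be deleted when a vertex moves to `I`.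
    record State (i : ℕ) : Set where
      field
        I R : List V
        Γ : List Triple
        I-unique : Unique I
        R-unique : Unique R
        I-length : length I ≡ i
        R⊆W : ∀ {x} → x ∈ R → x ∈ W
        apart : ∀ {x} → x ∈ I → x ∉ R
        indep₃ : ∀ {x y z} → x ∈ I → y ∈ I → z ∈ I → ¬ E x y z
        indep₂ : ∀ {x y z} → x ∈ I → y ∈ I → z ∈ R → ¬ E x y z
        hit : ∀ {x y z} → x ∈ I → y ∈ R → z ∈ R → E x y z →
              ∃[ t ] t ∈ Γ × (x , y , z) ≈ t
        Γ-length : length Γ ≤ i * (4 * (a * (d * d)))
        R-length : length W ≤ length R + i * (1 + 12 * (a * d))

    start : State 0
    start = record
      { I = [] ; R = W ; Γ = [] ; I-unique = [] ; R-unique = uW ; I-length = refl ; R⊆W = id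
      ; apart = λ () ; indep₃ = λ () ; indep₂ = λ () ; hit = λ () ; Γ-length = z≤n
      ; R-length = ≤-reflexive (sym (+-identityʳ _)) }

    module _ {i : ℕ} (i<n : i < n) (st : State i) where
      open State st

      private
        first∈? : (t : Triple) → Dec (proj₁ t ∈ R)
        first∈? t = proj₁ t ∈? R
        S′ = filter first∈? S

        through? : (w : V) (t : Triple) → Dec (w ∈ elems t)
        through? w t = w ∈? elems t

        deg : List Triple → V → ℕ
        deg T w = length (filter (through? w) T)

        S′-length : length S′ ≤ a * (d * d) * length R
        S′-length = ≤-trans
          (length-filter-sum first∈? (λ t → length (filter (λ v → proj₁ t ≟ᶠ v) R))
            (λ p → some p) S)
          (double-count (λ t v → proj₁ t ≟ᶠ v) S R (a * (d * d)) (λ {v} _ → few v))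
          where
          some : ∀ {x} → x ∈ R → 0 < length (filter (λ v → x ≟ᶠ v) R)
          some {x} x∈ with filter (λ v → x ≟ᶠ v) R | ∈-filter⁺ (λ v → x ≟ᶠ v) x∈ refl
          ... | _ ∷ _ | _ = s≤s z≤n

        deg-sum : ∀ T → sum (map (deg T) R) ≤ 3 * length T
        deg-sum T = double-count through? R T 3 λ {t} _ →
          distinct-length id {zs = elems t} (Uniqueₚ.filter⁺ (λ w → through? w t) R-unique)
            (λ w∈ → proj₂ (∈-filter⁻ (λ w → through? w t) {xs = R} w∈))

        R-large : 12 * (n * d) ≤ length R
        R-large = +-cancelˡ-≤ (n * (1 + 12 * (a * d))) _ _ (begin
          n * (1 + 12 * (a * d)) + 12 * (n * d)   ≤⟨ large ⟩
          length W                                ≤⟨ R-length ⟩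
          length R + i * (1 + 12 * (a * d))       ≤⟨ +-monoʳ-≤ (length R) (*-monoˡ-≤ (1 + 12 * (a * d)) (<⇒≤ i<n)) ⟩
          length R + n * (1 + 12 * (a * d))       ≡⟨ +-comm (length R) _ ⟩
          n * (1 + 12 * (a * d)) + length R       ∎)
          where open ≤-Reasoning

        R-nonempty : 0 < length R
        R-nonempty = <-≤-trans (*-mono-< {0} {12} (s≤s z≤n) (*-mono-< 0<n 0<d)) R-large

        -- Every triple is counted at three vertices at most. `S′` thus contributes 3ad² per vertex
        -- of `R`; `Γ`, weighted by d, contributes 12nad³ in total, which is at most ad² per vertex
        -- because `R` keeps at least 12nd vertices.
        total-weight : sum (map (λ w → deg S′ w + d * deg Γ w) R) ≤ 4 * (a * (d * d)) * length R
        total-weight = begin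
          sum (map (λ w → deg S′ w + d * deg Γ w) R)
            ≡⟨ sum-map-+ (deg S′) (λ w → d * deg Γ w) R ⟩
          sum (map (deg S′) R) + sum (map (λ w → d * deg Γ w) R)
            ≡⟨ cong (sum (map (deg S′) R) +_) (sum-map-* d (deg Γ) R) ⟩
          sum (map (deg S′) R) + d * sum (map (deg Γ) R)
            ≤⟨ +-mono-≤ (deg-sum S′) (*-monoʳ-≤ d (deg-sum Γ)) ⟩
          3 * length S′ + d * (3 * length Γ)
            ≤⟨ +-mono-≤ (*-monoʳ-≤ 3 S′-length) (*-monoʳ-≤ d (*-monoʳ-≤ 3
                 (≤-trans Γ-length (*-monoˡ-≤ (4 * (a * (d * d))) (<⇒≤ i<n))))) ⟩
          3 * (a * (d * d) * length R) + d * (3 * (n * (4 * (a * (d * d)))))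
            ≡⟨ cong (3 * (a * (d * d) * length R) +_) (lem₁ a d n) ⟩
          3 * (a * (d * d) * length R) + a * (d * d) * (12 * (n * d))
            ≤⟨ +-monoʳ-≤ (3 * (a * (d * d) * length R)) (*-monoʳ-≤ (a * (d * d)) R-large) ⟩
          3 * (a * (d * d) * length R) + a * (d * d) * length R
            ≡⟨ lem₂ (a * (d * d)) (length R) ⟩
          4 * (a * (d * d)) * length R ∎
          where
          open ≤-Reasoning
          lem₁ : ∀ a d n → d * (3 * (n * (4 * (a * (d * d))))) ≡ a * (d * d) * (12 * (n * d))
          lem₁ = solve-∀
          lem₂ : ∀ a r → 3 * (a * r) + a * r ≡ 4 * a * r
          lem₂ = solve-∀

      -- A single vertex `w` of at most average weight controls both costs: at most 4ad² edges are
      -- added to `Γ`, and, thanks to the factor `d` in the weight, at most 4ad edges of `Γ` contain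
      -- `w`.
      step : State (suc i)
      step = advance (below-average (λ w → deg S′ w + d * deg Γ w) R (4 * (a * (d * d))) R-nonempty total-weight)
        where
        advance : (∃[ w ] w ∈ R × deg S′ w + d * deg Γ w ≤ 4 * (a * (d * d))) → State (suc i)
        advance (w , w∈R , small) = record
          { I = w ∷ I ; R = R ∖ gone ; Γ = filter (through? w) S′ ++ Γ
          ; I-unique = unique-∷ (λ w∈I → apart w∈I w∈R) I-unique
          ; R-unique = ∖-unique gone R-unique
          ; I-length = cong suc I-length
          ; R⊆W = R⊆W ∘ inR
          ; apart = λ { (here refl) x∈ → kept x∈ (here refl) ; (there x∈I) x∈ → apart x∈I (inR x∈) }
          ; indep₃ = indep₃′
          ; indep₂ = indep₂′
          ; hit = hit′
          ; Γ-length = begin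
              length (filter (through? w) S′ ++ Γ)                  ≡⟨ length-++ (filter (through? w) S′) ⟩
              deg S′ w + length Γ                                   ≤⟨ +-mono-≤ (m+n≤o⇒m≤o _ small) Γ-length ⟩
              4 * (a * (d * d)) + i * (4 * (a * (d * d)))           ∎
          ; R-length = begin
              length W
                ≤⟨ R-length ⟩
              length R + i * (1 + 12 * (a * d))
                ≤⟨ +-monoˡ-≤ (i * (1 + 12 * (a * d))) (length-∖ gone R-unique) ⟩
              length (R ∖ gone) + length gone + i * (1 + 12 * (a * d))
                ≤⟨ +-monoˡ-≤ (i * (1 + 12 * (a * d))) (+-monoʳ-≤ (length (R ∖ gone)) (s≤s gone-length)) ⟩
              length (R ∖ gone) + (1 + 12 * (a * d)) + i * (1 + 12 * (a * d))
                ≡⟨ +-assoc (length (R ∖ gone)) _ _ ⟩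
              length (R ∖ gone) + suc i * (1 + 12 * (a * d)) ∎
          }
          where
          open ≤-Reasoning
          -- Any edge on `w`, a vertex of `I` and a vertex of `R` is recorded in `Γ`. Deleting all
          -- three entries of the recorded edges through `w` costs at most 12ad vertices and keeps
          -- `indep₂` valid.
          touched = filter (through? w) Γ
          gone = w ∷ concatMap elems touched
          inR : ∀ {x} → x ∈ R ∖ gone → x ∈ R
          inR x∈ = proj₁ (∈-∖⁻ gone x∈)
          kept : ∀ {x} → x ∈ R ∖ gone → x ∉ gone
          kept x∈ = proj₂ (∈-∖⁻ {xs = R} gone x∈)
          elems-length : ∀ T → length (concatMap elems T) ≡ 3 * length T
          elems-length [] = refl
          elems-length (t ∷ T) = trans (cong (3 +_) (elems-length T)) (sym (*-suc 3 (length T)))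
          degΓ : deg Γ w ≤ 4 * (a * d)
          degΓ = *-cancelˡ-≤ d {{>-nonZero 0<d}} (≤-trans (m+n≤o⇒n≤o (deg S′ w) small) (≤-reflexive (lem a d)))
            where
            lem : ∀ a d → 4 * (a * (d * d)) ≡ d * (4 * (a * d))
            lem = solve-∀
          gone-length : length (concatMap elems touched) ≤ 12 * (a * d)
          gone-length = begin
            length (concatMap elems touched)  ≡⟨ elems-length touched ⟩
            3 * deg Γ w                       ≤⟨ *-monoʳ-≤ 3 degΓ ⟩
            3 * (4 * (a * d))                 ≡⟨ sym (*-assoc 3 4 (a * d)) ⟩
            12 * (a * d)                      ∎
          removed : ∀ {x z} → x ∈ I → E x w z → z ∈ R → z ∈ gone
          removed x∈ e z∈ with hit x∈ w∈R z∈ e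
          ... | t , t∈ , p = there (∈-concatMap⁺ elems {xs = touched}
                  (lose (∈-filter⁺ (through? w) t∈ (elems-≈ p (there (here refl)))) (elems-≈ p (there (there (here refl))))))
          indep₃′ : ∀ {x y z} → x ∈ w ∷ I → y ∈ w ∷ I → z ∈ w ∷ I → ¬ E x y z
          indep₃′ (here refl) (here refl) _ e = E-≢ e refl
          indep₃′ (here refl) (there _) (here refl) e = E-≢ᵒ e refl
          indep₃′ (here refl) (there y∈) (there z∈) e = indep₂ y∈ z∈ w∈R (E-swapʳ (E-swapˡ e))
          indep₃′ (there _) (here refl) (here refl) e = E-≢ʳ e refl
          indep₃′ (there x∈) (here refl) (there z∈) e = indep₂ x∈ z∈ w∈R (E-swapʳ e)
          indep₃′ (there x∈) (there y∈) (here refl) e = indep₂ x∈ y∈ w∈R e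
          indep₃′ (there x∈) (there y∈) (there z∈) e = indep₃ x∈ y∈ z∈ e
          indep₂′ : ∀ {x y z} → x ∈ w ∷ I → y ∈ w ∷ I → z ∈ R ∖ gone → ¬ E x y z
          indep₂′ (here refl) (here refl) _ e = E-≢ e refl
          indep₂′ (here refl) (there y∈) z∈ e = kept z∈ (removed y∈ (E-swapˡ e) (inR z∈))
          indep₂′ (there x∈) (here refl) z∈ e = kept z∈ (removed x∈ e (inR z∈))
          indep₂′ (there x∈) (there y∈) z∈ e = indep₂ x∈ y∈ (inR z∈) e
          hit′ : ∀ {x y z} → x ∈ w ∷ I → y ∈ R ∖ gone → z ∈ R ∖ gone → E x y z →
                 ∃[ t ] t ∈ filter (through? w) S′ ++ Γ × (x , y , z) ≈ t
          hit′ (here refl) y∈ z∈ e with covering (R⊆W w∈R) (R⊆W (inR y∈)) (R⊆W (inR z∈)) e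
          ... | t , t∈ , p = t , ∈-++⁺ˡ (∈-filter⁺ (through? w) (∈-filter⁺ first∈? t∈ first) (elems-≈ p (here refl))) , p
            where
            first : proj₁ t ∈ R
            first with elems-≈ (≈-sym p) (here refl)
            ... | here eq = subst (_∈ R) (sym eq) w∈R
            ... | there (here eq) = subst (_∈ R) (sym eq) (inR y∈)
            ... | there (there (here eq)) = subst (_∈ R) (sym eq) (inR z∈)
          hit′ (there x∈) y∈ z∈ e with hit x∈ (inR y∈) (inR z∈) e
          ... | t , t∈ , p = t , ∈-++⁺ʳ (filter (through? w) S′) t∈ , p

    states : ∀ i → i ≤ n → State i
    states zero _ = start
    states (suc i) i<n = step i<n (states i (<⇒≤ i<n))

    independent : ∃[ I ] Unique I × length I ≡ n × (∀ {x y z} → x ∈ I → y ∈ I → z ∈ I → ¬ E x y z)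
    independent = let open State (states n ≤-refl) in I , I-unique , I-length , indep₃

-- Climbing the tree and assembling the argument.

module Bounds (l : ℕ) where
  open Constants l

  -- The vertices used for a new level, in units of `d * length I`: `2 + 2 * i` copies of the old
  -- level for `U`, one for the level itself, and `2 + D` vertices for each of the 4d triples
  -- collected per old vertex. The factor `κ i` compares the level with its reduced part.
  growth : ℕ → ℕ
  growth i = κ i * (3 + 2 * i + 4 * (2 + D))

  total-growth : ℕ → ℕ
  total-growth zero = growth 0
  total-growth (suc i) = growth (suc i) + total-growth i

  growth≤total : ∀ {i j} → i ≤ j → growth i ≤ total-growth j
  growth≤total {i} {j} i≤j with m≤n⇒m<n∨m≡n i≤j
  growth≤total {i} {suc j} _ | inj₁ (s≤s i≤j) = ≤-trans (growth≤total i≤j) (m≤n+m _ (growth (suc j)))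
  growth≤total {zero} _ | inj₂ refl = ≤-refl
  growth≤total {suc i} _ | inj₂ refl = m≤m+n _ _

module Main {N : ℕ} (G : Hypergraph N) (l q n d K a : ℕ)
            (growth<K : ∀ {i} → i ≤ q → Bounds.growth l i < K)
            (a-large : Constants.D l * (suc (Constants.D l) * (4 * Constants.κ l q)) ≤ a)
            (3≤l : 3 ≤ l) (short : 2 * suc q < l)
            (0<n : 0 < n) (0<d : 0 < d) (n≤d^k : n ≤ d ^ (2 + q))
            {X : Set} (found : LooseCycle G l → X)
            (independent : ∀ I → Unique I → n ≤ length I →
                           (∀ {x y z} → x ∈ I → y ∈ I → z ∈ I → ¬ Hypergraph.E G x y z) → X) where
  open Hypergraph G
  open Steps G l
  open Bounds l

  B : ℕ
  B = K * d

  κ-positive : 0 < κ q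
  κ-positive = m^n>0 Q {{>-nonZero (*-mono-< (<-≤-trans (s≤s z≤n) 3≤l) (s≤s z≤n))}} (length (meetings q))

  module _ (W : List V) (uW : Unique W) (expanding : Growth.Expanding {X} W B) where

    -- The losses `κ i` of the intermediate reductions are paid for by `K` in the expansion, so each
    -- level is a full factor d larger than the one before. The constant `κ q` is carried along
    -- unspent until the last reduction, which then still leaves d^(2+q) vertices, enough for n.
    climb : ∀ j i → i + j ≡ q → ∀ {L U} → Level i L U → Unique L → (∀ {x} → x ∈ L → x ∈ W) →
            κ q * d ^ (2 + i) ≤ length L → length U ≤ (2 + 2 * i) * length L → X
    climb j i i+j≡q {L} {U} 𝓛 uL L⊆W large narrow =
      [ id , ascend j i+j≡q ]′ (reduce found 𝓛 uL (≤-<-trans (*-monoʳ-≤ 2 (s≤s i≤q)) short))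
      where
      open ≤-Reasoning
      i≤q : i ≤ q
      i≤q = m+n≤o⇒m≤o i (≤-reflexive i+j≡q)
      Reduced : Set
      Reduced = ∃[ I ] (∀ {x} → x ∈ I → x ∈ L) × Unique I × length L ≤ κ i * length I ×
         (∀ {x y} → x ∈ I → y ∈ I → ¬ Heavy x y) ×
         (∀ {x y z} → x ∈ I → y ∈ I → z ∈ I → ¬ E x y z)
      L-positive : 0 < length L
      L-positive = <-≤-trans (*-mono-< κ-positive (m^n>0 d {{>-nonZero 0<d}} (2 + i))) large
      positive : ∀ m → length L ≤ κ i * m → 0 < m
      positive zero h = contradiction (≤-trans h (≤-reflexive (*-zeroʳ (κ i)))) (<⇒≱ L-positive)
      positive (suc m) _ = s≤s z≤n
      ℓ≤dℓ : length L ≤ d * length L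
      ℓ≤dℓ = ≤-trans (≤-reflexive (sym (*-identityˡ (length L)))) (*-monoˡ-≤ (length L) 0<d)
      room : ∀ m → length L ≤ κ i * m → length U + length L + 4 * (d * length L) * (2 + D) < B * m
      room m big = begin-strict
        length U + length L + 4 * (d * length L) * (2 + D)
          ≤⟨ +-monoˡ-≤ _ (+-monoˡ-≤ (length L) narrow) ⟩
        (2 + 2 * i) * length L + length L + 4 * (d * length L) * (2 + D)
          ≤⟨ +-monoˡ-≤ _ (+-mono-≤ (*-monoʳ-≤ (2 + 2 * i) ℓ≤dℓ) ℓ≤dℓ) ⟩
        (2 + 2 * i) * (d * length L) + d * length L + 4 * (d * length L) * (2 + D)
          ≡⟨ lem₁ i (d * length L) D ⟩
        d * length L * (3 + 2 * i + 4 * (2 + D))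
          ≤⟨ *-monoˡ-≤ (3 + 2 * i + 4 * (2 + D)) (*-monoʳ-≤ d big) ⟩
        d * (κ i * m) * (3 + 2 * i + 4 * (2 + D))
          ≡⟨ lem₂ d (κ i) m (3 + 2 * i + 4 * (2 + D)) ⟩
        growth i * (d * m)
          <⟨ *-monoˡ-< (d * m) {{>-nonZero (*-mono-< 0<d (positive m big))}} (growth<K i≤q) ⟩
        K * (d * m)
          ≡⟨ sym (*-assoc K d m) ⟩
        B * m ∎
        where
        lem₁ : ∀ i x D → (2 + 2 * i) * x + x + 4 * x * (2 + D) ≡ x * (3 + 2 * i + 4 * (2 + D))
        lem₁ = solve-∀
        lem₂ : ∀ d k x g → d * (k * x) * g ≡ k * g * (d * x)
        lem₂ = solve-∀
      continue : ∀ j → i + suc j ≡ q →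
                 (∃[ L′ ] ∃[ U′ ] Level (suc i) L′ U′ × Unique L′ × (∀ {x} → x ∈ L′ → x ∈ W) ×
                  4 * (d * length L) ≤ 4 * length L′ × length U′ ≡ length U + length L + length L′) → X
      continue j i+j≡q (L′ , U′ , 𝓛′ , uL′ , L′⊆W , more , size) =
        climb j (suc i) (trans (sym (+-suc i j)) i+j≡q) 𝓛′ uL′ L′⊆W large′ narrow′
        where
        dℓ≤ℓ′ : d * length L ≤ length L′
        dℓ≤ℓ′ = *-cancelˡ-≤ 4 more
        large′ : κ q * d ^ (3 + i) ≤ length L′
        large′ = begin
          κ q * (d * d ^ (2 + i))  ≡⟨ lem (κ q) d (d ^ (2 + i)) ⟩
          d * (κ q * d ^ (2 + i))  ≤⟨ *-monoʳ-≤ d large ⟩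
          d * length L             ≤⟨ dℓ≤ℓ′ ⟩
          length L′                ∎
          where
          lem : ∀ a b c → a * (b * c) ≡ b * (a * c)
          lem = solve-∀
        narrow′ : length U′ ≤ (2 + 2 * suc i) * length L′
        narrow′ = begin
          length U′                                        ≡⟨ size ⟩
          length U + length L + length L′                  ≤⟨ +-monoˡ-≤ (length L′) (+-monoˡ-≤ (length L) narrow) ⟩
          (2 + 2 * i) * length L + length L + length L′    ≤⟨ +-monoˡ-≤ (length L′)
            (+-mono-≤ (*-monoʳ-≤ (2 + 2 * i) ℓ≤ℓ′) ℓ≤ℓ′) ⟩
          (2 + 2 * i) * length L′ + length L′ + length L′  ≡⟨ lem i (length L′) ⟩
          (2 + 2 * suc i) * length L′                      ∎
          where
          ℓ≤ℓ′ = ≤-trans ℓ≤dℓ dℓ≤ℓ′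
          lem : ∀ i x → (2 + 2 * i) * x + x + x ≡ (2 + 2 * suc i) * x
          lem = solve-∀

      ascend : ∀ j → i + j ≡ q → Reduced → X
      ascend zero i≡q (I , I⊆L , uI , big , light , indep) =
        independent I uI (*-cancelˡ-≤ (κ q) {{>-nonZero κ-positive}} (begin
          κ q * n            ≤⟨ *-monoʳ-≤ (κ q) n≤d^k ⟩
          κ q * d ^ (2 + q)  ≡⟨ cong (λ i → κ q * d ^ (2 + i)) (sym i≡q′) ⟩
          κ q * d ^ (2 + i)  ≤⟨ large ⟩
          length L           ≤⟨ big ⟩
          κ i * length I     ≡⟨ cong (λ i → κ i * length I) i≡q′ ⟩
          κ q * length I     ∎)) indep
        where
        i≡q′ : i ≡ q
        i≡q′ = trans (sym (+-identityʳ i)) i≡q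
      ascend (suc j) eq (I , I⊆L , uI , big , light , indep) =
        [ id , continue j eq ]′ (Growth.grow W B expanding 𝓛 I I⊆L (L⊆W ∘ I⊆L) uI (positive _ big) light indep
                                (4 * (d * length L)) (room _ big))

    open Counting G l found 3≤l W uW

    -- `a` contains all losses of `seed` and the factor `κ q`. More than `a * (d * d)` views at one
    -- vertex therefore start a tree that is large enough for `climb`.
    sparse : ∀ S → Views S → ∀ v → X ⊎ length (filter (λ t → proj₁ t ≟ᶠ v) S) ≤ a * (d * d)
    sparse S vw v = decide (length (filter (λ t → proj₁ t ≟ᶠ v) S) ≤? a * (d * d))
      where
      Few : Set
      Few = length (filter (λ t → proj₁ t ≟ᶠ v) S) ≤ a * (d * d)
      seeded : ¬ Few → (∃[ L ] ∃[ U ] Level 0 L U × Unique L × (∀ {x} → x ∈ L → x ∈ W) ×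
        length (filter (λ t → proj₁ t ≟ᶠ v) S) ≤ D * (suc D * (4 * length L)) × length U ≡ suc (length L)) → X
      seeded gt (L , U , 𝓛 , uL , L⊆W , many , size) = climb q 0 refl 𝓛 uL L⊆W large narrow
        where
        open ≤-Reasoning
        larger : κ q * (d * d) < length L
        larger = ≰⇒> λ le → gt (begin
          length (filter (λ t → proj₁ t ≟ᶠ v) S)     ≤⟨ many ⟩
          D * (suc D * (4 * length L))               ≤⟨ *-monoʳ-≤ D (*-monoʳ-≤ (suc D) (*-monoʳ-≤ 4 le)) ⟩
          D * (suc D * (4 * (κ q * (d * d))))        ≡⟨ lem D (suc D) (κ q) (d * d) ⟩
          D * (suc D * (4 * κ q)) * (d * d)          ≤⟨ *-monoˡ-≤ (d * d) a-large ⟩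
          a * (d * d)                                ∎)
          where
          lem : ∀ a b c e → a * (b * (4 * (c * e))) ≡ a * (b * (4 * c)) * e
          lem = solve-∀
        large : κ q * d ^ 2 ≤ length L
        large = ≤-trans (≤-reflexive (cong (λ e → κ q * (d * e)) (*-identityʳ d))) (<⇒≤ larger)
        narrow : length U ≤ 2 * length L
        narrow = begin
          length U                      ≡⟨ size ⟩
          1 + length L                  ≤⟨ +-monoˡ-≤ (length L) (≤-trans (s≤s z≤n) larger) ⟩
          length L + length L           ≡⟨ cong (length L +_) (sym (+-identityʳ (length L))) ⟩
          2 * length L                  ∎
      decide : Dec Few → X ⊎ Few
      decide (yes le) = inj₂ le
      decide (no gt) = inj₁ (seeded gt (Seed.seed S vw v))

    inside-expander : n * (1 + 12 * (a * d)) + 12 * (n * d) ≤ length W → X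
    inside-expander large = [ id , (λ { (S , vw) → [ id , turán S vw ]′ (∀-or (sparse S vw)) }) ]′ views
      where
      turán : ∀ S → Views S → (∀ v → length (filter (λ t → proj₁ t ≟ᶠ v) S) ≤ a * (d * d)) → X
      turán S vw few =
        let I , uI , len , indep = Turán.independent S (Views.view-all vw) a d n 0<d 0<n few large
        in independent I uI (≤-reflexive (sym len)) indep

  -- Either R expands, or a badly expanding independent set is moved to S and a cover of its
  -- link is discarded, so that S stays independent of what remains.
  exhaust : n * (1 + B) + (n * (1 + 12 * (a * d)) + 12 * (n * d)) ≤ N →
            ∀ fuel S R → Unique S → Unique R → (∀ {x} → x ∈ S → x ∉ R) →
            (∀ {x y z} → x ∈ S → y ∈ S ++ R → z ∈ S ++ R → ¬ E x y z) →
            N ≤ length R + length S * (1 + B) → n ≤ length S + fuel → X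
  exhaust large fuel S R uS uR apart free size enough with n ≤? length S
  ... | yes n≤ = independent S uS n≤ λ x∈ y∈ z∈ → free x∈ (∈-++⁺ˡ y∈) (∈-++⁺ˡ z∈)
  exhaust large zero S R uS uR apart free size enough | no n≰ =
    contradiction (≤-trans enough (≤-reflexive (+-identityʳ _))) n≰
  exhaust large (suc fuel) S R uS uR apart free size enough | no n≰ =
    inside-expander R uR expanding (+-cancelˡ-≤ (n * (1 + B)) _ _ (begin
      n * (1 + B) + (n * (1 + 12 * (a * d)) + 12 * (n * d))  ≤⟨ large ⟩
      N                                                      ≤⟨ size ⟩
      length R + length S * (1 + B)                          ≤⟨ +-monoʳ-≤ (length R) (*-monoˡ-≤ (1 + B) (<⇒≤ (≰⇒> n≰))) ⟩
      length R + n * (1 + B)                                 ≡⟨ +-comm (length R) _ ⟩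
      n * (1 + B) + length R                                 ∎))
    where
    open ≤-Reasoning
    -- The recursion takes place inside the continuation. The nonempty `I` lets the fuel drop by
    -- one, and each vertex added to `S` is charged `1 + B` vertices of `R`: itself and its share of
    -- the cover.
    expanding : Growth.Expanding {X} R B
    expanding I C uI I⊆R posI covers fewC =
      exhaust large fuel (S ++ I) (R ∖ (I ++ C)) (Uniqueₚ.++⁺ uS uI λ { (s , i) → apart s (I⊆R i) })
        (∖-unique (I ++ C) uR) apart′ free′ size′ enough′
      where
      kept : ∀ {x} → x ∈ R ∖ (I ++ C) → x ∈ R × x ∉ I ++ C
      kept = ∈-∖⁻ (I ++ C)
      apart′ : ∀ {x} → x ∈ S ++ I → x ∉ R ∖ (I ++ C)
      apart′ x∈ x∈R with ∈-++⁻ S x∈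
      ... | inj₁ s = apart s (proj₁ (kept x∈R))
      ... | inj₂ i = proj₂ (kept x∈R) (∈-++⁺ˡ i)
      where-is : ∀ {x} → x ∈ (S ++ I) ++ (R ∖ (I ++ C)) → x ∈ S ⊎ (x ∈ R × (x ∈ C → x ∈ I))
      where-is x∈ with ∈-++⁻ (S ++ I) x∈
      ... | inj₂ r = inj₂ (proj₁ (kept r) , λ c → contradiction (∈-++⁺ʳ I c) (proj₂ (kept r)))
      ... | inj₁ si with ∈-++⁻ S si
      ...   | inj₁ s = inj₁ s
      ...   | inj₂ i = inj₂ (I⊆R i , λ _ → i)
      old : ∀ {x} → x ∈ S ⊎ (x ∈ R × (x ∈ C → x ∈ I)) → x ∈ S ++ R
      old (inj₁ s) = ∈-++⁺ˡ s
      old (inj₂ (r , _)) = ∈-++⁺ʳ S r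
      free′ : ∀ {x y z} → x ∈ S ++ I → y ∈ (S ++ I) ++ (R ∖ (I ++ C)) → z ∈ (S ++ I) ++ (R ∖ (I ++ C)) → ¬ E x y z
      free′ x∈ y∈ z∈ e with ∈-++⁻ S x∈ | where-is y∈ | where-is z∈
      ... | inj₁ s | yw | zw = free s (old yw) (old zw) e
      ... | inj₂ i | inj₁ s | zw = free s (∈-++⁺ʳ S (I⊆R i)) (old zw) (E-swapˡ e)
      ... | inj₂ i | inj₂ r | inj₁ s = free s (∈-++⁺ʳ S (I⊆R i)) (old (inj₂ r)) (E-swapˡ (E-swapʳ e))
      ... | inj₂ i | inj₂ (y∈R , fy) | inj₂ (z∈R , fz) with covers i y∈R z∈R e
      ...   | inj₁ (y∈C , y∉I) = y∉I (fy y∈C)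
      ...   | inj₂ (z∈C , z∉I) = z∉I (fz z∈C)
      size′ : N ≤ length (R ∖ (I ++ C)) + length (S ++ I) * (1 + B)
      size′ = begin
        N
          ≤⟨ size ⟩
        length R + length S * (1 + B)
          ≤⟨ +-monoˡ-≤ (length S * (1 + B)) (length-∖ (I ++ C) uR) ⟩
        length (R ∖ (I ++ C)) + length (I ++ C) + length S * (1 + B)
          ≡⟨ cong (λ x → length (R ∖ (I ++ C)) + x + length S * (1 + B)) (length-++ I) ⟩
        length (R ∖ (I ++ C)) + (length I + length C) + length S * (1 + B)
          ≤⟨ +-monoˡ-≤ (length S * (1 + B)) (+-monoʳ-≤ (length (R ∖ (I ++ C))) (+-monoʳ-≤ (length I) (<⇒≤ fewC))) ⟩
        length (R ∖ (I ++ C)) + (length I + B * length I) + length S * (1 + B)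
          ≡⟨ lem (length (R ∖ (I ++ C))) (length I) B (length S) ⟩
        length (R ∖ (I ++ C)) + (length S + length I) * (1 + B)
          ≡⟨ cong (λ x → length (R ∖ (I ++ C)) + x * (1 + B)) (sym (length-++ S)) ⟩
        length (R ∖ (I ++ C)) + length (S ++ I) * (1 + B) ∎
        where
        lem : ∀ r i b s → r + (i + b * i) + s * (1 + b) ≡ r + (s + i) * (1 + b)
        lem = solve-∀
      enough′ : n ≤ length (S ++ I) + fuel
      enough′ = begin
        n                                ≤⟨ enough ⟩
        length S + suc fuel              ≡⟨ +-suc (length S) fuel ⟩
        suc (length S) + fuel            ≤⟨ +-monoˡ-≤ fuel (begin
          suc (length S)                   ≡⟨ +-comm 1 (length S) ⟩
          length S + 1                     ≤⟨ +-monoʳ-≤ (length S) posI ⟩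
          length S + length I              ≡⟨ sym (length-++ S) ⟩
          length (S ++ I)                  ∎) ⟩
        length (S ++ I) + fuel           ∎

  cycle-or-independent : n * (1 + B) + (n * (1 + 12 * (a * d)) + 12 * (n * d)) ≤ N → X
  cycle-or-independent large = exhaust large n [] (allFin N) [] (Uniqueₚ.allFin⁺ N) (λ ()) (λ ())
    (≤-reflexive (sym (trans (+-identityʳ _) (length-tabulate id)))) ≤-refl

-- Translation between lists of vertices and subsets.

∣⁅x⁆∪p∣ : ∀ {N} {x : Fin N} {p : Subset N} → x ∉ˢ p → ∣ ⁅ x ⁆ ∪ p ∣ ≡ suc ∣ p ∣
∣⁅x⁆∪p∣ {x = fzero} {outside ∷ p} _ = cong (suc ∘ ∣_∣) (∪-identityˡ p)
∣⁅x⁆∪p∣ {x = fzero} {inside ∷ p} x∉ = contradiction Data.Vec.here x∉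
∣⁅x⁆∪p∣ {x = fsuc x} {outside ∷ p} x∉ = ∣⁅x⁆∪p∣ (x∉ ∘ Data.Vec.there)
∣⁅x⁆∪p∣ {x = fsuc x} {inside ∷ p} x∉ = cong suc (∣⁅x⁆∪p∣ (x∉ ∘ Data.Vec.there))

module _ {N : ℕ} where

  set : List (Fin N) → Subset N
  set [] = ∅
  set (x ∷ xs) = ⁅ x ⁆ ∪ set xs

  ∈-set⁺ : ∀ {x xs} → x ∈ xs → x ∈ˢ set xs
  ∈-set⁺ (here refl) = x∈p∪q⁺ (inj₁ (x∈⁅x⁆ _))
  ∈-set⁺ (there x∈) = x∈p∪q⁺ (inj₂ (∈-set⁺ x∈))

  ∈-set⁻ : ∀ {x} xs → x ∈ˢ set xs → x ∈ xs
  ∈-set⁻ [] x∈ = contradiction x∈ ∉⊥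
  ∈-set⁻ (y ∷ xs) x∈ with x∈p∪q⁻ ⁅ y ⁆ (set xs) x∈
  ... | inj₁ p = here (x∈⁅y⁆⇒x≡y y p)
  ... | inj₂ p = there (∈-set⁻ xs p)

  ∣set∣ : ∀ {xs} → Unique xs → ∣ set xs ∣ ≡ length xs
  ∣set∣ [] = ∣⊥∣≡0 N
  ∣set∣ {x ∷ xs} (p ∷ u) = trans (∣⁅x⁆∪p∣ λ x∈ → All.lookup p (∈-set⁻ xs x∈) refl) (cong suc (∣set∣ u))

  set-cong : ∀ {xs ys} → (∀ {x} → x ∈ xs → x ∈ ys) → (∀ {x} → x ∈ ys → x ∈ xs) → set xs ≡ set ys
  set-cong {xs} {ys} f g = ⊆-antisym (λ p → ∈-set⁺ (f (∈-set⁻ xs p))) (λ p → ∈-set⁺ (g (∈-set⁻ ys p)))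

  set-elements : (p : Subset N) → set (filter (_∈ˢ? p) (allFin N)) ≡ p
  set-elements p = ⊆-antisym
    (λ x∈ → proj₂ (∈-filter⁻ (_∈ˢ? p) {xs = allFin N} (∈-set⁻ _ x∈)))
    (λ {x} x∈ → ∈-set⁺ (∈-filter⁺ (_∈ˢ? p) (∈-allFin x) x∈))

  module _ (col : Colouring N) where

    red? : ∀ e → Dec (col e ≡ red)
    red? e with col e
    ... | red = yes refl
    ... | blue = no λ ()

    redGraph : Hypergraph N
    redGraph = record
      { E = λ x y z → Unique (x ∷ y ∷ z ∷ []) × col (set (x ∷ y ∷ z ∷ [])) ≡ red
      ; E? = λ x y z → unique? x y z ×-dec red? _
      ; E-swapˡ = λ { (((a ∷ b ∷ []) ∷ (c ∷ []) ∷ [] ∷ []) , r) →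
          ((a ∘ sym) ∷ c ∷ []) ∷ (b ∷ []) ∷ [] ∷ [] , trans (cong col (set-cong swapˡ swapˡ)) r }
      ; E-swapʳ = λ { (((a ∷ b ∷ []) ∷ (c ∷ []) ∷ [] ∷ []) , r) →
          (b ∷ a ∷ []) ∷ ((c ∘ sym) ∷ []) ∷ [] ∷ [] , trans (cong col (set-cong swapʳ swapʳ)) r }
      ; E-≢ = λ { (((a ∷ _) ∷ _) , _) → a } }
      where
      unique? : ∀ x y z → Dec (Unique (x ∷ y ∷ z ∷ []))
      unique? x y z = allPairs? (λ a b → ¬? (a ≟ᶠ b)) (x ∷ y ∷ z ∷ [])
      swapˡ : ∀ {a b c x : Fin N} → x ∈ a ∷ b ∷ c ∷ [] → x ∈ b ∷ a ∷ c ∷ []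
      swapˡ (here e) = there (here e)
      swapˡ (there (here e)) = here e
      swapˡ (there (there x∈)) = there (there x∈)
      swapʳ : ∀ {a b c x : Fin N} → x ∈ a ∷ b ∷ c ∷ [] → x ∈ a ∷ c ∷ b ∷ []
      swapʳ (here e) = here e
      swapʳ (there (here e)) = there (there (here e))
      swapʳ (there (there (here e))) = there (here e)

    independent⇒clique : ∀ {n} I → Unique I → n ≤ length I →
      (∀ {x y z} → x ∈ I → y ∈ I → z ∈ I → ¬ Hypergraph.E redGraph x y z) → BlueClique n col
    independent⇒clique {n} I uI n≤ indep = set kept , trans (∣set∣ (Uniqueₚ.take⁺ n uI)) (trans (length-take n I) (m≤n⇒m⊓n≡m n≤)) , blues
      where
      kept : List (Fin N)
      kept = take n I
      take⊆ : ∀ n {xs : List (Fin N)} {x} → x ∈ take n xs → x ∈ xs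
      take⊆ (suc n) {_ ∷ _} (here e) = here e
      take⊆ (suc n) {_ ∷ _} (there x∈) = there (take⊆ n x∈)
      blues : ∀ e → e ⊆ set kept → ∣ e ∣ ≡ 3 → col e ≡ blue
      blues e e⊆ ∣e∣≡3 with col e in eq
      ... | blue = refl
      ... | red = ⊥-elim (go (filter (_∈ˢ? e) (allFin N)) (set-elements e)
                    (Uniqueₚ.filter⁺ (_∈ˢ? e) (Uniqueₚ.allFin⁺ N)))
        where
        go : ∀ xs → set xs ≡ e → Unique xs → ⊥
        go xs refl u with trans (sym (∣set∣ u)) ∣e∣≡3
        go (x ∷ y ∷ z ∷ []) refl u | refl = indep (inI (here refl)) (inI (there (here refl)))
          (inI (there (there (here refl)))) (u , eq)
          where
          inI : ∀ {a} → a ∈ x ∷ y ∷ z ∷ [] → a ∈ I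
          inI a∈ = take⊆ n (∈-set⁻ kept (e⊆ (∈-set⁺ a∈)))

-- From closed paths to cyclically indexed edges.

module _ {N : ℕ} (G : Hypergraph N) where
  open Hypergraph G

  private
    FullPath = Path G (λ _ _ → ⊥)

  -- Vertices of the path by position: `joint p i` begins the `i`-th edge and `mid p i` is its third
  -- vertex. `joint p n` is the end of the path.
  joint mid : ∀ {u v n ys} → FullPath u v n ys → ℕ → Fin N
  joint {u = u} _ zero = u
  joint {v = v} [ _ ] (suc i) = v
  joint (_ ∷ p) (suc i) = joint p i
  mid [ edge {s} _ ] _ = s
  mid (edge {s} _ ∷ p) zero = s
  mid (edge _ ∷ p) (suc i) = mid p i

  joint-last : ∀ {u v n ys} (p : FullPath u v n ys) → joint p n ≡ v
  joint-last [ _ ] = refl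
  joint-last (_ ∷ p) = joint-last p

  joint-edge : ∀ {u v n ys} (p : FullPath u v n ys) {i} → i < n → E (joint p i) (joint p (suc i)) (mid p i)
  joint-edge [ edge e ] {zero} _ = e
  joint-edge [ edge e ] {suc i} (s≤s ())
  joint-edge (edge e ∷ [ _ ]) {zero} _ = e
  joint-edge (edge e ∷ _ ∷ _) {zero} _ = e
  joint-edge (edge _ ∷ p) {suc i} (s≤s lt) = joint-edge p lt

  joint∈ : ∀ {u v n ys} (p : FullPath u v n ys) {i} → i < n → joint p i ∈ u ∷ ys
  joint∈ p {zero} _ = here refl
  joint∈ [ _ ] {suc i} (s≤s ())
  joint∈ (edge _ ∷ p) {suc i} (s≤s lt) = there (there (joint∈ p lt))

  mid∈ : ∀ {u v n ys} (p : FullPath u v n ys) {i} → i < n → mid p i ∈ ys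
  mid∈ [ edge _ ] {zero} _ = here refl
  mid∈ [ _ ] {suc i} (s≤s ())
  mid∈ (edge _ ∷ p) {zero} _ = here refl
  mid∈ (edge _ ∷ p) {suc i} (s≤s lt) = there (there (mid∈ p lt))

  joint-injective : ∀ {u v n ys} (p : FullPath u v n ys) → Unique (u ∷ ys) → ∀ {i j} → i < n → j < n →
                    joint p i ≡ joint p j → i ≡ j
  joint-injective p _ {zero} {zero} _ _ _ = refl
  joint-injective [ _ ] _ {suc i} (s≤s ())
  joint-injective [ _ ] _ {_} {suc j} _ (s≤s ())
  joint-injective (edge _ ∷ p) u {zero} {suc j} _ (s≤s j<) eq =
    contradiction (subst (_∈ _) (sym eq) (there (joint∈ p j<))) (unique-head u)
  joint-injective (edge _ ∷ p) u {suc i} {zero} (s≤s i<) _ eq =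
    contradiction (subst (_∈ _) eq (there (joint∈ p i<))) (unique-head u)
  joint-injective (edge _ ∷ p) u {suc i} {suc j} (s≤s i<) (s≤s j<) eq =
    cong suc (joint-injective p (unique-tail (unique-tail u)) i< j< eq)

  mid-injective : ∀ {u v n ys} (p : FullPath u v n ys) → Unique (u ∷ ys) → ∀ {i j} → i < n → j < n →
                  mid p i ≡ mid p j → i ≡ j
  mid-injective p _ {zero} {zero} _ _ _ = refl
  mid-injective [ _ ] _ {suc i} (s≤s ())
  mid-injective [ _ ] _ {_} {suc j} _ (s≤s ())
  mid-injective (edge _ ∷ p) u {zero} {suc j} _ (s≤s j<) eq =
    contradiction (subst (_∈ _) (sym eq) (there (mid∈ p j<))) (unique-head (unique-tail u))
  mid-injective (edge _ ∷ p) u {suc i} {zero} (s≤s i<) _ eq =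
    contradiction (subst (_∈ _) eq (there (mid∈ p i<))) (unique-head (unique-tail u))
  mid-injective (edge _ ∷ p) u {suc i} {suc j} (s≤s i<) (s≤s j<) eq =
    cong suc (mid-injective p (unique-tail (unique-tail u)) i< j< eq)

  joint≢mid : ∀ {u v n ys} (p : FullPath u v n ys) → Unique (u ∷ ys) → ∀ {i j} → i < n → j < n →
              joint p i ≢ mid p j
  joint≢mid p u {zero} _ j< eq = unique-head u (subst (_∈ _) (sym eq) (mid∈ p j<))
  joint≢mid [ _ ] u {suc i} (s≤s ())
  joint≢mid (edge _ ∷ p) u {suc i} {zero} (s≤s i<) _ eq =
    unique-head (unique-tail u) (subst (_∈ _) eq (joint∈ p i<))
  joint≢mid (edge _ ∷ p) u {suc i} {suc j} (s≤s i<) (s≤s j<) = joint≢mid p (unique-tail (unique-tail u)) i< j<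

module Successor (m : ℕ) (2≤m : 2 ≤ m) where

  next : ℕ → ℕ
  next i = (i + 1) % suc m

  next-cases : ∀ {i} → i < suc m → (suc i < suc m × next i ≡ suc i) ⊎ (suc i ≡ suc m × next i ≡ 0)
  next-cases {i} i< with m≤n⇒m<n∨m≡n i<
  ... | inj₁ lt = inj₁ (lt , trans (cong (_% suc m) (+-comm i 1)) (m<n⇒m%n≡m lt))
  ... | inj₂ eq = inj₂ (eq , trans (cong (_% suc m) (trans (+-comm i 1) eq)) (n%n≡0 (suc m)))

  next< : ∀ {i} → i < suc m → next i < suc m
  next< i< with next-cases i<
  ... | inj₁ (lt , eq) = subst (_< suc m) (sym eq) lt
  ... | inj₂ (_ , eq) = subst (_< suc m) (sym eq) (s≤s z≤n)

  next-injective : ∀ {i j} → i < suc m → j < suc m → next i ≡ next j → i ≡ j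
  next-injective i< j< eq with next-cases i< | next-cases j<
  ... | inj₁ (_ , p) | inj₁ (_ , q) = suc-injective (trans (sym p) (trans eq q))
  ... | inj₂ (p , _) | inj₂ (q , _) = suc-injective (trans p (sym q))
  ... | inj₁ (_ , p) | inj₂ (_ , q) with trans (sym p) (trans eq q)
  ...   | ()
  next-injective i< j< eq | inj₂ (_ , p) | inj₁ (_ , q) with trans (sym p) (trans eq q)
  ...   | ()

  -- Two edges must not follow each other on both sides, for then they would share two joints. In a
  -- cycle of length 2 this happens, hence the bound `2 ≤ m`.
  next-next : ∀ {i j} → i < suc m → j ≡ next i → i ≢ next j
  next-next {i} i< refl eq with next-cases i< | next-cases (next< i<)
  ... | inj₁ (_ , p) | inj₁ (_ , q) = m≢1+n+m i {1} (trans eq (trans q (cong suc p)))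
  ... | inj₁ (_ , p) | inj₂ (q , r) with trans eq r
  ...   | refl with trans (cong suc (sym p)) q
  ...     | refl = contradiction 2≤m λ { (s≤s ()) }
  next-next {i} i< refl eq | inj₂ (p , q) | inj₁ (_ , r) with trans eq (trans r (cong suc q))
  ... | refl with suc-injective p
  ...   | refl = contradiction 2≤m λ { (s≤s ()) }
  next-next {i} i< refl eq | inj₂ (p , q) | inj₂ (r , s) with trans (cong suc (sym q)) r
  ... | refl = contradiction 2≤m λ ()

module _ {N : ℕ} (col : Colouring N) where

  loose⇒red : ∀ {l} → 3 ≤ l → LooseCycle (redGraph col) l → RedLooseCycle l col
  loose⇒red {suc m} (s≤s 2≤m) (u , ys , p , uys) = e ∘ toℕ ,
    (λ i → let q , r = edges (toℕ<n i) in trans (∣set∣ q) refl , r) ,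
    λ i j i≢j → (λ adj → ∣e∩e∣≡1 (toℕ<n i) (toℕ<n j) adj) ,
                λ ¬adj → ∣e∩e∣≡0 (toℕ<n i) (toℕ<n j) (i≢j ∘ toℕ-injective) ¬adj
    where
    open Successor m 2≤m
    con = joint (redGraph col) p
    s = mid (redGraph col) p
    vs : ℕ → List (Fin N)
    vs i = con i ∷ con (next i) ∷ s i ∷ []
    e : ℕ → Subset N
    e i = set (vs i)
    -- The last edge ends at joint number `suc m`, which is `u` again and thus joint 0.
    con-next : ∀ {i} → i < suc m → con (suc i) ≡ con (next i)
    con-next i< with next-cases i<
    ... | inj₁ (_ , eq) = cong con (sym eq)
    ... | inj₂ (refl , eq) = trans (joint-last (redGraph col) p) (cong con (sym eq))
    edges : ∀ {i} → i < suc m → Unique (vs i) × col (e i) ≡ red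
    edges {i} i< = subst (λ x → Unique (con i ∷ x ∷ s i ∷ []) × col (set (con i ∷ x ∷ s i ∷ [])) ≡ red)
      (con-next i<) (joint-edge (redGraph col) p i<)
    con-inj : ∀ {i j} → i < suc m → j < suc m → con i ≡ con j → i ≡ j
    con-inj = joint-injective (redGraph col) p uys
    -- All joints and third vertices at positions below `suc m` are distinct, so two edges can share
    -- only the joint at which one follows the other.
    common : ∀ {i j x} → i < suc m → j < suc m → i ≢ j → x ∈ vs i → x ∈ vs j →
             (j ≡ next i × x ≡ con j) ⊎ (i ≡ next j × x ≡ con i)
    common i< j< ne (here refl) (here eq) = contradiction (con-inj i< j< eq) ne
    common i< j< ne (here refl) (there (here eq)) = inj₂ (con-inj i< (next< j<) eq , refl)
    common i< j< ne (here refl) (there (there (here eq))) =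
      contradiction eq (joint≢mid (redGraph col) p uys i< j<)
    common i< j< ne (there (here refl)) (here eq) = inj₁ (sym (con-inj (next< i<) j< eq) , eq)
    common i< j< ne (there (here refl)) (there (here eq)) =
      contradiction (next-injective i< j< (con-inj (next< i<) (next< j<) eq)) ne
    common i< j< ne (there (here refl)) (there (there (here eq))) =
      contradiction eq (joint≢mid (redGraph col) p uys (next< i<) j<)
    common i< j< ne (there (there (here refl))) (here eq) =
      contradiction (sym eq) (joint≢mid (redGraph col) p uys j< i<)
    common i< j< ne (there (there (here refl))) (there (here eq)) =
      contradiction (sym eq) (joint≢mid (redGraph col) p uys (next< j<) i<)
    common i< j< ne (there (there (here refl))) (there (there (here eq))) =
      contradiction (mid-injective (redGraph col) p uys i< j< eq) ne

    Adjacent : ℕ → ℕ → Set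
    Adjacent i j = (j ≡ next i) ⊎ (i ≡ next j)

    adjacent≢ : ∀ {i} → i < suc m → i ≢ next i
    adjacent≢ i< eq = next-next i< eq eq

    single : ∀ {p} x → x ∈ˢ p → (∀ {y} → y ∈ˢ p → y ≡ x) → ∣ p ∣ ≡ 1
    single {p} x x∈ only = trans (cong ∣_∣ (⊆-antisym {i = p} {j = set (x ∷ [])}
      (λ y∈ → ∈-set⁺ {xs = x ∷ []} (here (only y∈))) λ y∈ → subst (_∈ˢ p) (sym (is y∈)) x∈)) (∣set∣ {xs = x ∷ []} ([] ∷ []))
      where
      is : ∀ {y} → y ∈ˢ set (x ∷ []) → y ≡ x
      is y∈ with ∈-set⁻ (x ∷ []) y∈
      ... | here eq = eq

    ∣e∩e∣≡1 : ∀ {i j} → i < suc m → j < suc m → Adjacent i j → ∣ e i ∩ e j ∣ ≡ 1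
    ∣e∩e∣≡1 {i} {j} i< j< (inj₁ refl) = single (con (next i))
      (x∈p∩q⁺ (∈-set⁺ {xs = vs i} (there (here refl)) , ∈-set⁺ {xs = vs (next i)} (here refl))) only
      where
      only : ∀ {y} → y ∈ˢ e i ∩ e (next i) → y ≡ con (next i)
      only y∈ with x∈p∩q⁻ (e i) (e (next i)) y∈
      ... | a , b with common i< j< (adjacent≢ i<) (∈-set⁻ (vs i) a) (∈-set⁻ (vs (next i)) b)
      ...   | inj₁ (_ , eq) = eq
      ...   | inj₂ (eq , _) = contradiction eq (next-next i< refl)
    ∣e∩e∣≡1 {i} {j} i< j< (inj₂ refl) = single (con (next j))
      (x∈p∩q⁺ (∈-set⁺ {xs = vs (next j)} (here refl) , ∈-set⁺ {xs = vs j} (there (here refl)))) only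
      where
      only : ∀ {y} → y ∈ˢ e (next j) ∩ e j → y ≡ con (next j)
      only y∈ with x∈p∩q⁻ (e (next j)) (e j) y∈
      ... | a , b with common i< j< (adjacent≢ j< ∘ sym) (∈-set⁻ (vs (next j)) a) (∈-set⁻ (vs j) b)
      ...   | inj₂ (_ , eq) = eq
      ...   | inj₁ (eq , _) = contradiction eq (next-next j< refl)

    ∣e∩e∣≡0 : ∀ {i j} → i < suc m → j < suc m → i ≢ j → ¬ Adjacent i j → ∣ e i ∩ e j ∣ ≡ 0
    ∣e∩e∣≡0 {i} {j} i< j< ne ¬adj = trans (cong ∣_∣ (⊆-antisym {i = e i ∩ e j} {j = ∅}
      (λ y∈ → contradiction y∈ none) (λ y∈ → contradiction y∈ ∉⊥))) (∣⊥∣≡0 N)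
      where
      none : ∀ {y} → y ∉ˢ e i ∩ e j
      none y∈ with x∈p∩q⁻ (e i) (e j) y∈
      ... | a , b with common i< j< ne (∈-set⁻ (vs i) a) (∈-set⁻ (vs j) b)
      ...   | inj₁ (eq , _) = ¬adj (inj₁ eq)
      ...   | inj₂ (eq , _) = ¬adj (inj₂ eq)

-- Choice of d and N, and the final bound.

^-distribʳ-* : ∀ k m n → (m * n) ^ k ≡ m ^ k * n ^ k
^-distribʳ-* zero m n = refl
^-distribʳ-* (suc k) m n = trans (cong (m * n *_) (^-distribʳ-* k m n)) ([m*n]*[o*p]≡[m*o]*[n*p] m n _ _)

-- The root `d` stays the same as long as its power suffices and is otherwise raised by one. In that
-- case the old power was still below the new number, and `suc d ≤ 2 * d` costs the factor
-- `2 ^ suc k`.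
rounded-root : ∀ k n → ∃[ d ] 0 < d × suc n ≤ d ^ suc k × d ^ suc k ≤ 2 ^ suc k * suc n
rounded-root k zero = 1 , s≤s z≤n , ≤-reflexive (sym (^-zeroˡ (suc k))) , (begin
  1 ^ suc k       ≡⟨ ^-zeroˡ (suc k) ⟩
  1               ≤⟨ m^n>0 2 (suc k) ⟩
  2 ^ suc k       ≡⟨ sym (*-identityʳ _) ⟩
  2 ^ suc k * 1   ∎)
  where open ≤-Reasoning
rounded-root k (suc n) with rounded-root k n
... | d , 0<d , lo , hi with suc (suc n) ≤? d ^ suc k
...   | yes le = d , 0<d , le , ≤-trans hi (*-monoʳ-≤ (2 ^ suc k) (n≤1+n (suc n)))
...   | no ¬le = suc d , s≤s z≤n , ≤-trans (s≤s lo) (^-monoˡ-< (suc k) (n<1+n d)) , (begin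
  suc d ^ suc k                    ≤⟨ ^-monoˡ-≤ (suc k) (+-mono-≤ 0<d (m≤m+n d 0)) ⟩
  (2 * d) ^ suc k                  ≡⟨ ^-distribʳ-* (suc k) 2 d ⟩
  2 ^ suc k * d ^ suc k            ≤⟨ *-monoʳ-≤ (2 ^ suc k) (<⇒≤ (≰⇒> ¬le)) ⟩
  2 ^ suc k * suc (suc n)          ∎)
  where open ≤-Reasoning

-- With k = 2 + q.
ramsey : ∀ l q → 3 ≤ l → 2 * suc q < l → ∃[ c ] (0 < c × ((n : ℕ) → ∃[ N ]
         (N ^ (2 + q) ≤ c ^ (2 + q) * n ^ (2 + q + 1) × RamseyProp l n N)))
-- The factor 2 absorbs the rounding of d, whose k-th power is at most `2 ^ k * n`.
ramsey l q 3≤l short = 2 * C , s≤s z≤n , bound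
  where
  open Constants l using (D; κ)
  open Bounds l
  K a C : ℕ
  K = suc (total-growth q)
  a = D * (suc D * (4 * κ q))
  -- The coefficient of `n * d` in the number of vertices needed, once every term `n` has been
  -- enlarged to `n * d`.
  C = suc (K + (1 + 12 * a + 12))
  bound : (n : ℕ) → ∃[ N ] (N ^ (2 + q) ≤ (2 * C) ^ (2 + q) * n ^ (2 + q + 1) × RamseyProp l n N)
  bound zero = 0 , z≤n , λ col → inj₂ ([] , refl , λ { [] _ () })
  bound n@(suc n-1) with rounded-root (1 + q) n-1
  ... | d , 0<d , lo , hi = C * (n * d) , size ,
    λ col → Main.cycle-or-independent (redGraph col) l q n d K a (s≤s ∘ growth≤total) ≤-refl 3≤l short (s≤s z≤n) 0<d lo
      (inj₁ ∘ loose⇒red col 3≤l) (λ I uI n≤ indep → inj₂ (independent⇒clique col I uI n≤ indep)) enough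
    where
    open ≤-Reasoning
    k = 2 + q
    size : (C * (n * d)) ^ k ≤ (2 * C) ^ k * n ^ (k + 1)
    size = begin
      (C * (n * d)) ^ k                  ≡⟨ ^-distribʳ-* k C (n * d) ⟩
      C ^ k * (n * d) ^ k                ≡⟨ cong (C ^ k *_) (^-distribʳ-* k n d) ⟩
      C ^ k * (n ^ k * d ^ k)            ≤⟨ *-monoʳ-≤ (C ^ k) (*-monoʳ-≤ (n ^ k) hi) ⟩
      C ^ k * (n ^ k * (2 ^ k * n))      ≡⟨ lem (C ^ k) (n ^ k) (2 ^ k) n ⟩
      2 ^ k * C ^ k * (n ^ k * (n * 1))  ≡⟨ cong₂ _*_ (sym (^-distribʳ-* k 2 C)) (sym (^-distribˡ-+-* n k 1)) ⟩
      (2 * C) ^ k * n ^ (k + 1)          ∎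
      where
      lem : ∀ a b c n → a * (b * (c * n)) ≡ c * a * (b * (n * 1))
      lem = solve-∀
    enough : n * (1 + K * d) + (n * (1 + 12 * (a * d)) + 12 * (n * d)) ≤ C * (n * d)
    enough = begin
      n * (1 + K * d) + (n * (1 + 12 * (a * d)) + 12 * (n * d))
        ≤⟨ +-mono-≤ (*-monoʳ-≤ n (+-monoˡ-≤ (K * d) 0<d))
             (+-monoˡ-≤ (12 * (n * d)) (*-monoʳ-≤ n (+-monoˡ-≤ (12 * (a * d)) 0<d))) ⟩
      n * (d + K * d) + (n * (d + 12 * (a * d)) + 12 * (n * d))
        ≡⟨ lem n d K a ⟩
      C * (n * d) ∎
      where
      lem : ∀ n d K a → n * (d + K * d) + (n * (d + 12 * (a * d)) + 12 * (n * d)) ≡ suc (K + (1 + 12 * a + 12)) * (n * d)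
      lem = solve-∀

theorem1p5 : (l : ℕ) → 3 ≤ l →
    ∃[ c ] (0 < c × ((n : ℕ) → ∃[ N ]
    (N ^ (suc l / 2) ≤ c ^ (suc l / 2) * n ^ (suc l / 2 + 1) × RamseyProp l n N)))
theorem1p5 l 3≤l = go (suc l / 2) (/-monoˡ-≤ 2 (s≤s 3≤l)) (m/n*n≤m (suc l) 2)
  where
  go : ∀ k → 2 ≤ k → k * 2 ≤ suc l →
       ∃[ c ] (0 < c × ((n : ℕ) → ∃[ N ] (N ^ k ≤ c ^ k * n ^ (k + 1) × RamseyProp l n N)))
  -- With k = q + 2, the inequality `k * 2 ≤ suc l` says exactly that a route of 2(k - 1) links is
  -- shorter than `l`.
  go (suc (suc q)) (s≤s (s≤s z≤n)) (s≤s le) = ramsey l q 3≤l (subst (_≤ l) (cong suc (*-comm (suc q) 2)) le)
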